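{- Let $G$ be a finite non-abelian $p$-group ($p$ a prime). Then the enhanced power graph $\mathcal{G}_e(G)$ satisfies the cone property if and only if $G$ is a generalized quaternion group.
   Context: For a group $G$, the enhanced power graph $\mathcal{G}_e(G)$ is the simple undirected graph with vertex set $G$ in which two distinct vertices $x,y$ are adjacent if there exists $z\in G$ with $x=z^m$ and $y=z^n$ for some $m,n\in\mathbb{N}$. $\mathcal{G}_e(G)$ satisfies the cone property if it has a cone vertex, i.e. a vertex other than the identity element that is adjacent to every other vertex. -}

module Defs where

open import Level using (0ℓ)
open import Data.Nat using (ℕ; zero; suc; _+_; _*_; _∸_; _^_; NonZero)
open import Data.Nat.Properties using (m^n≢0)
open import Data.Nat.DivMod using (_mod_)
open import Data.Nat.Primality using (Prime)
open import Data.Fin using (Fin; toℕ)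
open import Data.Bool using (Bool; true; false)
open import Data.Product using (Σ; ∃; ∃-syntax; _×_; _,_)
open import Relation.Binary.PropositionalEquality using (_≡_)
open import Relation.Nullary using (¬_)
open import Algebra.Structures using (IsGroup)
open import Function.Definitions using (Bijective)

record FiniteGroup : Set where
  field
    order : ℕ
    _∙_   : Fin order → Fin order → Fin order
    ε     : Fin order
    _⁻¹   : Fin order → Fin order
    isGroup : IsGroup _≡_ _∙_ ε _⁻¹

  Carrier : Set
  Carrier = Fin order

  pow : Carrier → ℕ → Carrier
  pow z zero    = ε
  pow z (suc m) = z ∙ pow z m

open FiniteGroup public

IsAbelian : FiniteGroup → Set
IsAbelian G = ∀ (x y : Carrier G) → _∙_ G x y ≡ _∙_ G y x

IsPGroup : ℕ → FiniteGroup → Set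
IsPGroup p G = ∃[ k ] order G ≡ p ^ k

-- Adjacency in the enhanced power graph 𝒢ₑ(G) (simple graph: distinct vertices;
-- exponents m, n range over positive naturals)
EPAdj : (G : FiniteGroup) → Carrier G → Carrier G → Set
EPAdj G x y = ¬ (x ≡ y) × ∃[ z ] ∃[ m ] ∃[ n ] (x ≡ pow G z (suc m) × y ≡ pow G z (suc n))

IsConeVertex : (G : FiniteGroup) → Carrier G → Set
IsConeVertex G v = ¬ (v ≡ ε G) × (∀ w → ¬ (w ≡ v) → EPAdj G v w)

ConeProperty : FiniteGroup → Set
ConeProperty G = ∃[ v ] IsConeVertex G v

-- The generalized quaternion group Q_{2^(k+3)} (order 2^(k+3), k ≥ 0, i.e. n ≥ 3)
--   ⟨ x, y | x^(2^(n-1)) = 1, y² = x^(2^(n-2)), y⁻¹ x y = x⁻¹ ⟩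
-- modelled concretely: the element x^a y^b is (a , b) with a ∈ ℤ/2^(k+2), b ∈ {0,1}.
module Quaternion (k : ℕ) where
  m : ℕ
  m = 2 ^ (k + 2)

  instance
    m-nonZero : NonZero m
    m-nonZero = m^n≢0 2 (k + 2)

  Q : Set
  Q = Fin m × Bool

  -- x^a y^b · x^c y^d, using y x^c = x^(-c) y and y² = x^(2^(k+1))
  _⋆_ : Q → Q → Q
  (a , false) ⋆ (c , d)     = ((toℕ a + toℕ c) mod m , d)
  (a , true)  ⋆ (c , false) = ((toℕ a + (m ∸ toℕ c)) mod m , true)
  (a , true)  ⋆ (c , true)  = ((toℕ a + (m ∸ toℕ c) + 2 ^ (k + 1)) mod m , false)

IsGeneralizedQuaternion : FiniteGroup → Set
IsGeneralizedQuaternion G =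
  ∃[ k ] Σ (Carrier G → Quaternion.Q k) λ f →
    Bijective _≡_ _≡_ f × (∀ x y → f (_∙_ G x y) ≡ Quaternion._⋆_ k (f x) (f y))

{-# OPTIONS --safe #-}
module Submission where

open import Defs
open import Level using (0ℓ)
open import Data.Nat using (ℕ)
open import Data.Nat.Base using (zero; suc; pred; _+_; _*_; _∸_; _^_; _≤_; _<_; z≤n; s≤s; s≤s⁻¹; NonZero; NonTrivial; ≢-nonZero; >-nonZero; nonTrivial⇒n>1; nonTrivial⇒≢1)
open import Data.Nat.Properties hiding (_≟_)
open import Data.Nat.Coprimality using (Coprime; coprime-divisor; coprime-Bézout)
open import Data.Nat.Divisibility
open import Data.Nat.DivMod using (_%_; _/_; _mod_; m≡m%n+[m/n]*n; m%n<n; [m+n]%n≡m%n; m<n⇒m%n≡m; %-distribˡ-+)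
open import Data.Nat.GCD using (module Bézout)
open import Data.Nat.Primality using (Prime; prime[2]; prime⇒nonZero; prime⇒nonTrivial; prime⇒irreducible)
open import Data.Nat.Solver using (module +-*-Solver)
open import Data.Bool.Base using (Bool; true; false; not)
open import Data.Fin.Base using (Fin; zero; suc; toℕ; fromℕ<)
open import Data.Fin.Permutation using (Permutation′; permutation; _⟨$⟩ʳ_)
open import Data.Fin.Properties using (any?; all?; pigeonhole; ¬∀⟶∃¬; toℕ<n; toℕ-fromℕ<; toℕ-injective) renaming (_≟_ to _≟ᶠ_)
open import Data.List.Base using (List; []; _∷_)
open import Data.Product using (∃-syntax; _×_; _,_; proj₁; proj₂)
open import Data.Sum as Sum using (_⊎_; inj₁; inj₂; [_,_]′)
open import Data.Vec.Base using (Vec; lookup)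
open import Function using (_∘_; mk⇔)
open import Function.Bundles using (_⇔_)
open import Algebra.Properties.Semiring.Sum +-*-semiring using (sum; sum-cong-≗; sum-permute; ∑-comm; ∑-distrib-+; *-distribʳ-sum; sum-replicate-zero)
open import Algebra.Structures using (IsGroup)
open import Relation.Nullary using (¬_; Dec; yes; no; contradiction; ¬?; _×-dec_; _⊎-dec_; decidable-stable)
open import Relation.Nullary.Decidable using (map′)
open import Relation.Unary using (Pred; Decidable; _⊆_)
open import Relation.Binary.Definitions using (Tri; tri<; tri≈; tri>)
open import Relation.Binary.PropositionalEquality using (_≡_; _≢_; refl; sym; trans; cong; cong₂; subst; setoid; module ≡-Reasoning)
import Relation.Binary.Reflection

-- A cone vertex v lies in a common cyclic subgroup with every element, so a power c of v of
-- order p is central and generates the only subgroup of order p. Let x have maximal order pⁿ⁺¹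
-- and x₀ = x^(pⁿ). Normalizers grow in p-groups, so if ⟨x⟩ ≠ G there is y ∉ ⟨x⟩ with
-- yx = xʳy and yᵖ ∈ ⟨x⟩. Since (xⁱy)ᵖ = x^(i(1 + r + ⋯ + rᵖ⁻¹)) yᵖ, unless p = 2 and r ≡ 3 mod 4
-- some xⁱy has order p although it is not in ⟨x⟩. In the remaining case uniqueness of the
-- involution x₀ forces r ≡ −1 and y² = x₀. The normalizer N of ⟨x⟩ is then ⟨x⟩ ∪ ⟨x⟩y, and
-- it is all of G: otherwise N grows too, which forces x to have order 4, but then ⟨x⟩ is normal.

-- Cardinalities of decidable subsets of Fin N

-- The converse is a computation: in Q the element x^(2^(k+1)) is a power of x and the square of
-- every xᵃy, so it shares a cyclic subgroup with each element. In the other direction r ≡ 1 mod p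
-- because x₀ is central, so 1 + r + ⋯ + rᵖ⁻¹ is p times a number prime to p outside the exceptional
-- case. Solving for i also requires yᵖ to be x to a multiple of p. Maximality of the order of x
-- supplies this: otherwise yᵖ would generate ⟨x⟩, and y would have larger order than x. Past
-- Lagrange's theorem the order of x enters only through two facts, that p^(n+1) annihilates every
-- element and that x^(pⁿ) ≠ 1; division of exponents becomes inversion modulo |G|. Growth of
-- normalizers comes from counting double cosets, which avoids quotient groups and an induction over
-- the centre. All searches run over a finite set, so every choice and every case distinction is
-- decidable.

private variable
  N : ℕ

Subset : ℕ → Set₁
Subset N = Pred (Fin N) 0ℓ

indicator : {A : Set} → Dec A → ℕ
indicator (yes _) = 1
indicator (no _)  = 0

indicator-cong : {A B : Set} (a? : Dec A) (b? : Dec B) → (A → B) → (B → A) → indicator a? ≡ indicator b?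
indicator-cong (yes a) (yes b) f g = refl
indicator-cong (yes a) (no ¬b) f g = contradiction (f a) ¬b
indicator-cong (no ¬a) (yes b) f g = contradiction (g b) ¬a
indicator-cong (no ¬a) (no ¬b) f g = refl

indicator-yes : {A : Set} (a? : Dec A) → A → indicator a? ≡ 1
indicator-yes (yes _) a = refl
indicator-yes (no ¬a) a = contradiction a ¬a

indicator-no : {A : Set} (a? : Dec A) → ¬ A → indicator a? ≡ 0
indicator-no (yes a) ¬a = contradiction a ¬a
indicator-no (no _)  ¬a = refl

size : {P : Subset N} → Decidable P → ℕ
size P? = sum (indicator ∘ P?)

size-cong : {P Q : Subset N} (P? : Decidable P) (Q? : Decidable Q) → P ⊆ Q → Q ⊆ P → size P? ≡ size Q?
size-cong P? Q? P⊆Q Q⊆P = sum-cong-≗ λ i → indicator-cong (P? i) (Q? i) P⊆Q Q⊆P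

size-full : {P : Subset N} (P? : Decidable P) → (∀ i → P i) → size P? ≡ N
size-full {zero}  P? all = refl
size-full {suc N} P? all = cong₂ _+_ (indicator-yes (P? zero) (all zero)) (size-full (P? ∘ suc) (all ∘ suc))

size-empty : {P : Subset N} (P? : Decidable P) → (∀ i → ¬ P i) → size P? ≡ 0
size-empty {N} P? none = trans (sum-cong-≗ λ i → indicator-no (P? i) (none i)) (sum-replicate-zero N)

size-positive : {P : Subset N} (P? : Decidable P) {i : Fin N} → P i → 0 < size P?
size-positive P? {zero}  Pi = <-≤-trans (≤-reflexive (sym (indicator-yes (P? zero) Pi))) (m≤m+n _ _)
size-positive P? {suc i} Pi = <-≤-trans (size-positive (P? ∘ suc) Pi) (m≤n+m _ _)

size-split : {U V : Subset N} (U? : Decidable U) (V? : Decidable V) →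
  size U? ≡ size (λ i → U? i ×-dec V? i) + size (λ i → U? i ×-dec ¬? (V? i))
size-split U? V? = trans (sum-cong-≗ λ i → split (U? i) (V? i))
  (∑-distrib-+ (λ i → indicator (U? i ×-dec V? i)) (λ i → indicator (U? i ×-dec ¬? (V? i))))
  where
  split : {A B : Set} (a? : Dec A) (b? : Dec B) →
    indicator a? ≡ indicator (a? ×-dec b?) + indicator (a? ×-dec ¬? b?)
  split (yes _) (yes _) = refl
  split (yes _) (no _)  = refl
  split (no _)  (yes _) = refl
  split (no _)  (no _)  = refl

size-⊆-split : {P Q : Subset N} (P? : Decidable P) (Q? : Decidable Q) → P ⊆ Q →
  size Q? ≡ size P? + size (λ i → Q? i ×-dec ¬? (P? i))
size-⊆-split P? Q? P⊆Q = trans (size-split Q? P?)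
  (cong (_+ size (λ i → Q? i ×-dec ¬? (P? i))) (size-cong (λ i → Q? i ×-dec P? i) P? proj₂ λ p → P⊆Q p , p))

size-permute : {P : Subset N} (P? : Decidable P) (π : Permutation′ N) → size (P? ∘ (π ⟨$⟩ʳ_)) ≡ size P?
size-permute P? π = sym (sum-permute (indicator ∘ P?) π)

sum-constant : {P : Subset N} (P? : Decidable P) (f : Fin N → ℕ) (c : ℕ) →
  (∀ {i} → P i → f i ≡ c) → (∀ {i} → ¬ P i → f i ≡ 0) → sum f ≡ size P? * c
sum-constant P? f c on off = trans (sum-cong-≗ pointwise) (sym (*-distribʳ-sum c (indicator ∘ P?)))
  where
  pointwise : ∀ i → f i ≡ indicator (P? i) * c
  pointwise i with P? i
  ... | yes p = trans (on p) (sym (*-identityˡ c))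
  ... | no ¬p = off ¬p

-- Count the pairs (i , y) with f i ≡ y in two ways: each y in P has exactly one preimage, other y
-- have none, and each i has exactly one image.
size-image : ∀ {m} {P : Subset N} (P? : Decidable P) (f : Fin m → Fin N) →
  (∀ {i j} → f i ≡ f j → i ≡ j) → (∀ i → P (f i)) → (∀ {y} → P y → ∃[ i ] f i ≡ y) → size P? ≡ m
size-image {N} {m} {P} P? f injective into onto = begin
  size P?                                         ≡⟨ sym (*-identityʳ _) ⟩
  size P? * 1                                     ≡⟨ sym (sum-constant P? _ 1 fibre off-image) ⟩
  sum (λ y → sum (λ i → indicator (f i ≟ᶠ y)))    ≡⟨ ∑-comm (λ y i → indicator (f i ≟ᶠ y)) ⟩
  sum (λ i → sum (λ y → indicator (f i ≟ᶠ y)))    ≡⟨ sum-constant everything _ 1 (λ {i} _ → singleton (f i)) (λ ¬i≡i → contradiction refl ¬i≡i) ⟩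
  size everything * 1                             ≡⟨ *-identityʳ _ ⟩
  size everything                                 ≡⟨ size-full everything (λ _ → refl) ⟩
  m                                               ∎
  where
  open ≡-Reasoning
  everything : Decidable {A = Fin m} (λ i → i ≡ i)
  everything i = i ≟ᶠ i
  singleton : ∀ {k} (a : Fin k) → sum (λ y → indicator (a ≟ᶠ y)) ≡ 1
  singleton {suc k} zero = cong suc (size-empty {k} (λ y → zero ≟ᶠ suc y) λ _ ())
  singleton {suc k} (suc a) = trans (size-cong (λ y → suc a ≟ᶠ suc y) (a ≟ᶠ_) (λ { refl → refl }) (cong suc)) (singleton a)
  fibre : ∀ {y} → P y → sum (λ i → indicator (f i ≟ᶠ y)) ≡ 1
  fibre {y} Py with onto Py
  ... | i , refl = trans (size-cong (λ j → f j ≟ᶠ y) (i ≟ᶠ_) (sym ∘ injective) (cong f ∘ sym)) (singleton i)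
  off-image : ∀ {y} → ¬ P y → sum (λ i → indicator (f i ≟ᶠ y)) ≡ 0
  off-image ¬Py = size-empty (λ i → f i ≟ᶠ _) λ { i refl → ¬Py (into i) }

-- Equivalence relations and unions of classes

record Partition (N : ℕ) : Set₁ where
  field
    _~_     : Fin N → Fin N → Set
    _~?_    : ∀ a b → Dec (a ~ b)
    ~-refl  : ∀ {a} → a ~ a
    ~-sym   : ∀ {a b} → a ~ b → b ~ a
    ~-trans : ∀ {a b c} → a ~ b → b ~ c → a ~ c

module _ (𝓟 : Partition N) where
  open Partition 𝓟

  -- Removing the class of a member of U leaves a smaller subset that is again a union of classes;
  -- `s` bounds the size for the recursion. With cosets as classes this yields Lagrange's theorem,
  -- with double cosets the growth of normalizers.
  ∣classes⇒∣size : {U : Subset N} (U? : Decidable U) (d : ℕ) →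
    (∀ {a b} → U a → a ~ b → U b) → (∀ {a} → U a → d ∣ size (a ~?_)) → d ∣ size U?
  ∣classes⇒∣size U? d closed d∣class = go (size U?) U? ≤-refl closed d∣class
    where
    go : ∀ s {U : Subset N} (U? : Decidable U) → size U? ≤ s →
      (∀ {a b} → U a → a ~ b → U b) → (∀ {a} → U a → d ∣ size (a ~?_)) → d ∣ size U?
    go s U? U≤s closed d∣class with any? U?
    ... | no empty = subst (d ∣_) (sym (size-empty U? λ i Ui → empty (i , Ui))) (d ∣0)
    go zero U? U≤s closed d∣class | yes (a , Ua) = contradiction (size-positive U? Ua) (≤⇒≯ U≤s)
    go (suc s) {U} U? U≤s closed d∣class | yes (a , Ua) =
      subst (d ∣_) (sym split) (∣m∣n⇒∣m+n (d∣class Ua)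
        (go s rest? (s≤s⁻¹ (≤-trans rest<U U≤s))
          (λ (Ub , a≁b) b~c → closed Ub b~c , λ a~c → a≁b (~-trans a~c (~-sym b~c)))
          (d∣class ∘ proj₁)))
      where
      rest? : Decidable (λ b → U b × ¬ (a ~ b))
      rest? b = U? b ×-dec ¬? (a ~? b)
      split : size U? ≡ size (a ~?_) + size rest?
      split = size-⊆-split (a ~?_) U? (closed Ua)
      rest<U : size rest? < size U?
      rest<U = subst (size rest? <_) (sym split) (+-monoˡ-≤ (size rest?) (size-positive (a ~?_) {a} ~-refl))

-- Arithmetic of a prime

least : {P : ℕ → Set} → Decidable P → ∀ {m} → P m → ∃[ l ] P l × (∀ {j} → j < l → ¬ P j)
least P? {zero} P0 = 0 , P0 , λ ()
least {P} P? {suc m} Psm with P? 0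
... | yes P0 = 0 , P0 , λ ()
... | no ¬P0 with l , Pl , below ← least (P? ∘ suc) Psm = suc l , Pl , minimal
  where
  minimal : ∀ {j} → j < suc l → ¬ P j
  minimal {zero}  _         = ¬P0
  minimal {suc j} (s≤s j<l) = below j<l

module PrimeArithmetic (p : ℕ) (p-prime : Prime p) where

  instance
    p-nonZero : NonZero p
    p-nonZero = prime⇒nonZero p-prime

    p-nonTrivial : NonTrivial p
    p-nonTrivial = prime⇒nonTrivial p-prime

  ∤⇒coprime-^ : ∀ {u} → p ∤ u → ∀ k → Coprime u (p ^ k)
  ∤⇒coprime-^ p∤u zero    (d∣u , d∣1) = ∣1⇒≡1 d∣1
  ∤⇒coprime-^ {u} p∤u (suc k) {d} (d∣u , d∣p^k+1) = ∤⇒coprime-^ p∤u k (d∣u , coprime-divisor d⊥p d∣p^k+1)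
    where
    d⊥p : Coprime d p
    d⊥p (e∣d , e∣p) with prime⇒irreducible p-prime e∣p
    ... | inj₁ e≡1  = e≡1
    ... | inj₂ refl = contradiction (∣-trans e∣d d∣u) p∤u

  ∣^⇒≡1∨∣ : ∀ {d} k → d ∣ p ^ k → d ≡ 1 ⊎ p ∣ d
  ∣^⇒≡1∨∣ {d} k d∣p^k with p ∣? d
  ... | yes p∣d = inj₂ p∣d
  ... | no  p∤d = inj₁ (∤⇒coprime-^ p∤d k (∣-refl , d∣p^k))

  p≡2∨odd : p ≡ 2 ⊎ ∃[ h ] p ≡ suc (2 * h)
  p≡2∨odd with 2 ∣? p
  ... | yes 2∣p with prime⇒irreducible p-prime 2∣p
  ...   | inj₂ 2≡p = inj₁ (sym 2≡p)
  p≡2∨odd | no 2∤p = inj₂ (odd p 2∤p)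
    where
    odd : ∀ m → 2 ∤ m → ∃[ h ] m ≡ suc (2 * h)
    odd zero          2∤0 = contradiction (2 ∣0) 2∤0
    odd (suc zero)    _   = 0 , refl
    odd (suc (suc m)) 2∤m with h , refl ← odd m (λ 2∣m → 2∤m (∣m∣n⇒∣m+n ∣-refl 2∣m)) = suc h , cong suc (sym (*-suc 2 h))

module GroupTheory (G : FiniteGroup) where
  open FiniteGroup G public using ()
    renaming (order to ∣G∣; Carrier to C; _∙_ to infixl 7 _·_; ε to 𝟙; _⁻¹ to infix 9 _⁻; pow to infixl 8 _↑_)
  open IsGroup (FiniteGroup.isGroup G) public using (assoc; identityˡ; identityʳ; inverseˡ; inverseʳ)

  infix 4 _≟_
  _≟_ : (a b : C) → Dec (a ≡ b)
  _≟_ = _≟ᶠ_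

  -- The word problem of free groups

  data Word (n : ℕ) : Set where
    var   : Fin n → Word n
    :1    : Word n
    _:·_  : Word n → Word n → Word n
    _:⁻   : Word n → Word n

  infixl 7 _:·_
  infix 9 _:⁻

  module _ {n : ℕ} where

    Letter : Set
    Letter = Bool × Fin n

    reduce : Letter → List Letter → List Letter
    reduce a [] = a ∷ []
    reduce (true  , i) ((false , j) ∷ l) with i ≟ᶠ j
    ... | yes _ = l
    ... | no  _ = (true , i) ∷ (false , j) ∷ l
    reduce (false , i) ((true  , j) ∷ l) with i ≟ᶠ j
    ... | yes _ = l
    ... | no  _ = (false , i) ∷ (true , j) ∷ l
    reduce a l = a ∷ l

    -- The Boolean is the sign under which the word is read, so inverses are carried down to the
    -- letters. Cancelling at each push keeps the list freely reduced; both sides of an identity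
    -- valid in all groups then compute to the same list, and `refl` settles it.
    push : Bool → Word n → List Letter → List Letter
    push s     (var i)  l = reduce (s , i) l
    push s     :1       l = l
    push true  (a :· b) l = push true a (push true b l)
    push false (a :· b) l = push false b (push false a l)
    push s     (a :⁻)   l = push (not s) a l

    module _ (ρ : Vec C n) where

      ⟦_⟧′ : Word n → C
      ⟦ var i ⟧′  = lookup ρ i
      ⟦ :1 ⟧′     = 𝟙
      ⟦ a :· b ⟧′ = ⟦ a ⟧′ · ⟦ b ⟧′
      ⟦ a :⁻ ⟧′   = ⟦ a ⟧′ ⁻

      signed : Bool → C → C
      signed true  a = a
      signed false a = a ⁻

      evalList : List Letter → C
      evalList []            = 𝟙
      evalList ((s , i) ∷ l) = signed s (lookup ρ i) · evalList l

      ⁻-cancelˡ : ∀ a b → a ⁻ · (a · b) ≡ b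
      ⁻-cancelˡ a b = trans (sym (assoc _ _ _)) (trans (cong (_· b) (inverseˡ a)) (identityˡ b))

      cancelˡ-⁻ : ∀ a b → a · (a ⁻ · b) ≡ b
      cancelˡ-⁻ a b = trans (sym (assoc _ _ _)) (trans (cong (_· b) (inverseʳ a)) (identityˡ b))

      ⁻-unique : ∀ a b → a · b ≡ 𝟙 → b ≡ a ⁻
      ⁻-unique a b ab≡𝟙 = trans (sym (⁻-cancelˡ a b)) (trans (cong (a ⁻ ·_) ab≡𝟙) (identityʳ _))

      reduce-sound : ∀ s i l → evalList (reduce (s , i) l) ≡ signed s (lookup ρ i) · evalList l
      reduce-sound s i [] = refl
      reduce-sound true  i ((true  , j) ∷ l) = refl
      reduce-sound false i ((false , j) ∷ l) = refl
      reduce-sound true  i ((false , j) ∷ l) with i ≟ᶠ j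
      ... | yes refl = sym (cancelˡ-⁻ _ _)
      ... | no  _    = refl
      reduce-sound false i ((true  , j) ∷ l) with i ≟ᶠ j
      ... | yes refl = sym (⁻-cancelˡ _ _)
      ... | no  _    = refl

      signed-not : ∀ s a → signed (not s) a ≡ signed s (a ⁻)
      signed-not true  a = refl
      signed-not false a = ⁻-unique (a ⁻) a (inverseˡ a)

      ⁻-anti : ∀ a b → b ⁻ · a ⁻ ≡ (a · b) ⁻
      ⁻-anti a b = ⁻-unique _ _ (trans (assoc a b _) (trans (cong (a ·_) (cancelˡ-⁻ b _)) (inverseʳ a)))

      push-sound : ∀ s w l → evalList (push s w l) ≡ signed s ⟦ w ⟧′ · evalList l
      push-sound s     (var i)  l = reduce-sound s i l
      push-sound true  :1       l = sym (identityˡ _)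
      push-sound false :1       l = trans (sym (identityˡ _)) (cong (_· evalList l) (⁻-unique 𝟙 𝟙 (identityˡ 𝟙)))
      push-sound true  (a :· b) l =
        trans (push-sound true a _) (trans (cong (⟦ a ⟧′ ·_) (push-sound true b l)) (sym (assoc _ _ _)))
      push-sound false (a :· b) l =
        trans (push-sound false b _) (trans (cong (⟦ b ⟧′ ⁻ ·_) (push-sound false a l))
          (trans (sym (assoc _ _ _)) (cong (_· evalList l) (⁻-anti _ _))))
      push-sound s     (a :⁻)   l = trans (push-sound (not s) a l) (cong (_· evalList l) (signed-not s _))

  ⟦_⟧ ⟦_⇓⟧ : ∀ {n} → Word n → Vec C n → C
  ⟦ w ⟧ ρ   = ⟦_⟧′ ρ w
  ⟦ w ⇓⟧ ρ = evalList ρ (push true w [])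

  ⇓-correct : ∀ {n} (w : Word n) ρ → ⟦ w ⇓⟧ ρ ≡ ⟦ w ⟧ ρ
  ⇓-correct w ρ = trans (push-sound ρ true w []) (identityʳ _)

  open Relation.Binary.Reflection (setoid C) var ⟦_⟧ ⟦_⇓⟧ ⇓-correct public
    using (_⊜_) renaming (solve to word-solve)

  ·-cancelˡ : ∀ a {b c} → a · b ≡ a · c → b ≡ c
  ·-cancelˡ a {b} {c} ab≡ac = trans (word-solve 2 (λ a b → b ⊜ a :⁻ :· (a :· b)) refl a b)
    (trans (cong (a ⁻ ·_) ab≡ac) (word-solve 2 (λ a c → a :⁻ :· (a :· c) ⊜ c) refl a c))

  ·-cancelʳ : ∀ a {b c} → b · a ≡ c · a → b ≡ c
  ·-cancelʳ a {b} {c} ba≡ca = trans (word-solve 2 (λ a b → b ⊜ b :· a :· a :⁻) refl a b)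
    (trans (cong (_· a ⁻) ba≡ca) (word-solve 2 (λ a c → c :· a :· a :⁻ ⊜ c) refl a c))

  -- Laws of exponents

  ↑-+ : ∀ a i j → a ↑ (i + j) ≡ a ↑ i · a ↑ j
  ↑-+ a zero    j = sym (identityˡ _)
  ↑-+ a (suc i) j = trans (cong (a ·_) (↑-+ a i j)) (sym (assoc _ _ _))

  ↑-* : ∀ a i j → a ↑ (i * j) ≡ (a ↑ j) ↑ i
  ↑-* a zero    j = refl
  ↑-* a (suc i) j = trans (↑-+ a j (i * j)) (cong (a ↑ j ·_) (↑-* a i j))

  ↑-*′ : ∀ a i j → a ↑ (i * j) ≡ (a ↑ i) ↑ j
  ↑-*′ a i j = trans (cong (a ↑_) (*-comm i j)) (↑-* a j i)

  𝟙↑ : ∀ i → 𝟙 ↑ i ≡ 𝟙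
  𝟙↑ zero    = refl
  𝟙↑ (suc i) = trans (identityˡ _) (𝟙↑ i)

  ↑-1 : ∀ a → a ↑ 1 ≡ a
  ↑-1 = identityʳ

  ↑-2 : ∀ a → a ↑ 2 ≡ a · a
  ↑-2 a = cong (a ·_) (identityʳ a)

  ↑-comm : ∀ a i j → a ↑ i · a ↑ j ≡ a ↑ j · a ↑ i
  ↑-comm a i j = trans (sym (↑-+ a i j)) (trans (cong (a ↑_) (+-comm i j)) (↑-+ a j i))

  ∣⇒↑≡𝟙 : ∀ {a d i} → a ↑ d ≡ 𝟙 → d ∣ i → a ↑ i ≡ 𝟙
  ∣⇒↑≡𝟙 {a} {d} a↑d≡𝟙 (divides q refl) = trans (↑-* a q d) (trans (cong (_↑ q) a↑d≡𝟙) (𝟙↑ q))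

  ↑-% : ∀ a i d .{{_ : NonZero d}} → a ↑ d ≡ 𝟙 → a ↑ i ≡ a ↑ (i % d)
  ↑-% a i d a↑d≡𝟙 = begin
    a ↑ i                          ≡⟨ cong (a ↑_) (m≡m%n+[m/n]*n i d) ⟩
    a ↑ (i % d + i / d * d)        ≡⟨ ↑-+ a (i % d) _ ⟩
    a ↑ (i % d) · a ↑ (i / d * d)  ≡⟨ cong (a ↑ (i % d) ·_) (∣⇒↑≡𝟙 a↑d≡𝟙 (n∣m*n (i / d))) ⟩
    a ↑ (i % d) · 𝟙                ≡⟨ identityʳ _ ⟩
    a ↑ (i % d)                    ∎
    where open ≡-Reasoning

  ↑-∸ : ∀ a {i j} → i ≤ j → a ↑ i ≡ a ↑ j → a ↑ (j ∸ i) ≡ 𝟙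
  ↑-∸ a {i} {j} i≤j eq = ·-cancelˡ (a ↑ i)
    (trans (sym (↑-+ a i (j ∸ i))) (trans (cong (a ↑_) (m+[n∸m]≡n i≤j)) (trans (sym eq) (sym (identityʳ _)))))

  -- Subgroups and Lagrange's theorem

  record Subgroup : Set₁ where
    field
      Mem : C → Set
      mem? : Decidable Mem
      𝟙∈ : Mem 𝟙
      ·∈ : ∀ {a b} → Mem a → Mem b → Mem (a · b)
      ⁻∈ : ∀ {a} → Mem a → Mem (a ⁻)

    card : ℕ
    card = size mem?

    ↑∈ : ∀ {a} i → Mem a → Mem (a ↑ i)
    ↑∈ zero    a∈ = 𝟙∈
    ↑∈ (suc i) a∈ = ·∈ a∈ (↑∈ i a∈)

    instance
      nonZero : NonZero card
      nonZero = >-nonZero (size-positive mem? 𝟙∈)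

  open Subgroup using (Mem; mem?; 𝟙∈; ·∈; ⁻∈; card)

  whole : Subgroup
  whole = record { Mem = λ a → a ≡ a ; mem? = λ a → a ≟ a ; 𝟙∈ = refl ; ·∈ = λ _ _ → refl ; ⁻∈ = λ _ → refl }

  card-whole : card whole ≡ ∣G∣
  card-whole = size-full (mem? whole) λ _ → refl

  translateˡ translateʳ : C → Permutation′ ∣G∣
  translateˡ a = permutation (a ·_) (a ⁻ ·_)
    (word-solve 2 (λ a b → a :· (a :⁻ :· b) ⊜ b) refl a)
    (word-solve 2 (λ a b → a :⁻ :· (a :· b) ⊜ b) refl a)
  translateʳ a = permutation (_· a) (_· a ⁻)
    (word-solve 2 (λ a b → b :· a :⁻ :· a ⊜ b) refl a)
    (word-solve 2 (λ a b → b :· a :· a :⁻ ⊜ b) refl a)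

  leftCosets : Subgroup → Partition ∣G∣
  leftCosets S = record
    { _~_     = λ a b → Mem S (a ⁻ · b)
    ; _~?_    = λ a b → mem? S (a ⁻ · b)
    ; ~-refl  = λ {a} → subst (Mem S) (sym (inverseˡ a)) (𝟙∈ S)
    ; ~-sym   = λ {a} {b} ab → subst (Mem S) (word-solve 2 (λ a b → (a :⁻ :· b) :⁻ ⊜ b :⁻ :· a) refl a b) (⁻∈ S ab)
    ; ~-trans = λ {a} {b} {c} ab bc →
        subst (Mem S) (word-solve 3 (λ a b c → (a :⁻ :· b) :· (b :⁻ :· c) ⊜ a :⁻ :· c) refl a b c) (·∈ S ab bc)
    }

  lagrange : (S H : Subgroup) → Mem S ⊆ Mem H → card S ∣ card H
  lagrange S H S⊆H = ∣classes⇒∣size (leftCosets S) (mem? H) (card S)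
    (λ {a} {b} Ha ab → subst (Mem H) (word-solve 2 (λ a b → a :· (a :⁻ :· b) ⊜ b) refl a b) (·∈ H Ha (S⊆H ab)))
    (λ {a} _ → ∣-reflexive (sym (size-permute (mem? S) (translateˡ (a ⁻)))))

  lagrange′ : (S : Subgroup) → card S ∣ ∣G∣
  lagrange′ S = subst (card S ∣_) card-whole (lagrange S whole λ _ → refl)

  -- Any exponent e annihilating x will do: it bounds the search that decides membership, and since
  -- i + i(e - 1) = ie it turns inverses into powers with natural exponents.
  cyclic : ∀ x e → .{{_ : NonZero e}} → x ↑ e ≡ 𝟙 → Subgroup
  cyclic x e x↑e≡𝟙 = record
    { Mem  = λ a → ∃[ i ] x ↑ i ≡ a
    ; mem? = λ a → map′ (λ (i , eq) → toℕ i , eq) (λ { (i , refl) → residue i }) (any? λ (i : Fin e) → x ↑ toℕ i ≟ a)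
    ; 𝟙∈   = 0 , refl
    ; ·∈   = λ { (i , refl) (j , refl) → i + j , ↑-+ x i j }
    ; ⁻∈   = λ { (i , refl) → i * pred e , inverse i }
    }
    where
    residue : ∀ i → ∃[ j ] x ↑ toℕ {e} j ≡ x ↑ i
    residue i = fromℕ< (m%n<n i e) , trans (cong (x ↑_) (toℕ-fromℕ< (m%n<n i e))) (sym (↑-% x i e x↑e≡𝟙))
    inverse : ∀ i → x ↑ (i * pred e) ≡ (x ↑ i) ⁻
    inverse i = ·-cancelˡ (x ↑ i) (begin
      x ↑ i · x ↑ (i * pred e)  ≡⟨ sym (↑-+ x i _) ⟩
      x ↑ (i + i * pred e)      ≡⟨ cong (x ↑_) (sym (*-suc i (pred e))) ⟩
      x ↑ (i * suc (pred e))    ≡⟨ cong (λ e → x ↑ (i * e)) (suc-pred e) ⟩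
      x ↑ (i * e)               ≡⟨ ∣⇒↑≡𝟙 x↑e≡𝟙 (n∣m*n i) ⟩
      𝟙                         ≡⟨ sym (inverseʳ _) ⟩
      x ↑ i · (x ↑ i) ⁻         ∎)
      where open ≡-Reasoning

  -- For the least positive e with x^e = 1 the powers below e are distinct, so ⟨x⟩ has exactly e
  -- elements and e divides |G| by Lagrange.
  ↑order : ∀ x → x ↑ ∣G∣ ≡ 𝟙
  ↑order x = ∣⇒↑≡𝟙 x↑e≡𝟙 (subst (_∣ ∣G∣) card-⟨x⟩ (lagrange′ ⟨x⟩))
    where
    torsion : ∃[ e ] x ↑ suc e ≡ 𝟙
    torsion with i , j , i<j , eq ← pigeonhole (n<1+n ∣G∣) (λ (i : Fin (suc ∣G∣)) → x ↑ toℕ i) =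
      toℕ j ∸ suc (toℕ i) , trans (cong (x ↑_) (sym (+-∸-assoc 1 i<j))) (↑-∸ x (<⇒≤ i<j) eq)
    -- The search is over the predecessor of the exponent, which excludes the trivial exponent 0.
    leastExponent : ∃[ e ] x ↑ suc e ≡ 𝟙 × (∀ {j} → j < e → x ↑ suc j ≢ 𝟙)
    leastExponent = least (λ e → x ↑ suc e ≟ 𝟙) {proj₁ torsion} (proj₂ torsion)
    e : ℕ
    e = suc (proj₁ leastExponent)
    x↑e≡𝟙 : x ↑ e ≡ 𝟙
    x↑e≡𝟙 = proj₁ (proj₂ leastExponent)
    minimal : ∀ {j} → suc j < e → x ↑ suc j ≢ 𝟙
    minimal (s≤s j<e) = proj₂ (proj₂ leastExponent) j<e
    ⟨x⟩ : Subgroup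
    ⟨x⟩ = cyclic x e x↑e≡𝟙
    distinct : ∀ {i j} → i < j → j < e → x ↑ i ≢ x ↑ j
    distinct {i} {suc j} i<j j<e eq = minimal (≤-<-trans (s≤s (m∸n≤m j i)) j<e)
      (trans (cong (x ↑_) (sym (+-∸-assoc 1 (≤-pred i<j)))) (↑-∸ x (<⇒≤ i<j) eq))
    injective : ∀ {i j : Fin e} → x ↑ toℕ i ≡ x ↑ toℕ j → i ≡ j
    injective {i} {j} eq with <-cmp (toℕ i) (toℕ j)
    ... | tri< i<j _ _ = contradiction eq (distinct i<j (toℕ<n j))
    ... | tri≈ _ i≡j _ = toℕ-injective i≡j
    ... | tri> _ _ j<i = contradiction (sym eq) (distinct j<i (toℕ<n i))
    card-⟨x⟩ : card ⟨x⟩ ≡ e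
    card-⟨x⟩ = size-image (mem? ⟨x⟩) (λ i → x ↑ toℕ i) injective (λ i → toℕ i , refl)
      λ { (i , refl) → fromℕ< (m%n<n i e) , trans (cong (x ↑_) (toℕ-fromℕ< (m%n<n i e))) (sym (↑-% x i e x↑e≡𝟙)) }

  -- Double cosets

  module _ (H : Subgroup) where

    -- The condition a⁻¹hb ∈ H says hb ∈ aH, so a and b are related when HaH = HbH. The second
    -- factor from H is hidden in the membership, leaving a single search over G.
    doubleCosets : Partition ∣G∣
    doubleCosets = record
      { _~_     = λ a b → ∃[ h ] Mem H h × Mem H (a ⁻ · (h · b))
      ; _~?_    = λ a b → any? λ h → mem? H h ×-dec mem? H (a ⁻ · (h · b))
      ; ~-refl  = λ {a} → 𝟙 , 𝟙∈ H , subst (Mem H) (word-solve 1 (λ a → :1 ⊜ a :⁻ :· (:1 :· a)) refl a) (𝟙∈ H)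
      ; ~-sym   = λ {a} {b} (h , Hh , Hahb) → h ⁻ , ⁻∈ H Hh ,
          subst (Mem H) (word-solve 3 (λ a b h → (a :⁻ :· (h :· b)) :⁻ ⊜ b :⁻ :· (h :⁻ :· a)) refl a b h) (⁻∈ H Hahb)
      ; ~-trans = λ {a} {b} {c} (h , Hh , Hahb) (k , Hk , Hbkc) → h · k , ·∈ H Hh Hk ,
          subst (Mem H)
            (word-solve 5 (λ a b c h k → (a :⁻ :· (h :· b)) :· (b :⁻ :· (k :· c)) ⊜ a :⁻ :· (h :· k :· c)) refl a b c h k)
            (·∈ H Hahb Hbkc)
      }

    open Partition doubleCosets

    -- This is H ∩ gHg⁻¹, the stabiliser of the coset gH when H acts by left multiplication.
    _∩ᶜ : C → Subgroup
    g ∩ᶜ = record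
      { Mem  = λ h → Mem H h × Mem H (g ⁻ · (h · g))
      ; mem? = λ h → mem? H h ×-dec mem? H (g ⁻ · (h · g))
      ; 𝟙∈   = 𝟙∈ H , subst (Mem H) (word-solve 1 (λ g → :1 ⊜ g :⁻ :· (:1 :· g)) refl g) (𝟙∈ H)
      ; ·∈   = λ {h} {k} (Hh , Hh′) (Hk , Hk′) → ·∈ H Hh Hk ,
          subst (Mem H)
            (word-solve 3 (λ g h k → (g :⁻ :· (h :· g)) :· (g :⁻ :· (k :· g)) ⊜ g :⁻ :· (h :· k :· g)) refl g h k)
            (·∈ H Hh′ Hk′)
      ; ⁻∈   = λ {h} (Hh , Hh′) → ⁻∈ H Hh ,
          subst (Mem H) (word-solve 2 (λ g h → (g :⁻ :· (h :· g)) :⁻ ⊜ g :⁻ :· (h :⁻ :· g)) refl g h) (⁻∈ H Hh′)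
      }

    -- Count the pairs (h , y) with h ∈ H and y ∈ h⁻¹gH in two ways.
    card-doubleCoset : ∀ g → size (g ~?_) * card (g ∩ᶜ) ≡ card H * card H
    card-doubleCoset g = begin
      size (g ~?_) * card (g ∩ᶜ)                     ≡⟨ sym (sum-constant (g ~?_) _ (card (g ∩ᶜ)) overClass outsideClass) ⟩
      sum (λ y → sum (λ h → indicator (pair? h y)))  ≡⟨ ∑-comm (λ y h → indicator (pair? h y)) ⟩
      sum (λ h → sum (λ y → indicator (pair? h y)))  ≡⟨ sum-constant (mem? H) _ (card H) overH outsideH ⟩
      card H * card H                                ∎
      where
      open ≡-Reasoning
      pair? : ∀ h y → Dec (Mem H h × Mem H (g ⁻ · (h · y)))
      pair? h y = mem? H h ×-dec mem? H (g ⁻ · (h · y))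
      overH : ∀ {h} → Mem H h → size (pair? h) ≡ card H
      overH {h} Hh = trans
        (size-cong (pair? h) (λ y → mem? H (g ⁻ · h · y))
          (λ (_ , p) → subst (Mem H) (sym (assoc _ _ _)) p)
          (λ p → Hh , subst (Mem H) (assoc _ _ _) p))
        (size-permute (mem? H) (translateˡ (g ⁻ · h)))
      outsideH : ∀ {h} → ¬ Mem H h → size (pair? h) ≡ 0
      outsideH {h} ¬Hh = size-empty (pair? h) λ _ (Hh , _) → ¬Hh Hh
      outsideClass : ∀ {y} → ¬ (g ~ y) → size (λ h → pair? h y) ≡ 0
      outsideClass {y} g≁y = size-empty (λ h → pair? h y) λ h p → g≁y (h , p)
      overClass : ∀ {y} → g ~ y → size (λ h → pair? h y) ≡ card (g ∩ᶜ)
      -- Given one solution k, the elements h over the same y form the translate (H ∩ gHg⁻¹)k,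
      -- because g⁻¹hk⁻¹g = (g⁻¹hy)(g⁻¹ky)⁻¹.
      overClass {y} (k , Hk , Hgky) = trans
        (size-cong (λ h → pair? h y) (λ h → mem? (g ∩ᶜ) (h · k ⁻))
          (λ {h} (Hh , Hghy) → ·∈ H Hh (⁻∈ H Hk) ,
            subst (Mem H)
              (word-solve 4 (λ g h k y → (g :⁻ :· (h :· y)) :· (g :⁻ :· (k :· y)) :⁻ ⊜ g :⁻ :· (h :· k :⁻ :· g)) refl g h k y)
              (·∈ H Hghy (⁻∈ H Hgky)))
          (λ {h} (Hhk , Hghkg) →
            subst (Mem H) (word-solve 2 (λ h k → h :· k :⁻ :· k ⊜ h) refl h k) (·∈ H Hhk Hk) ,
            subst (Mem H)
              (word-solve 4 (λ g h k y → (g :⁻ :· (h :· k :⁻ :· g)) :· (g :⁻ :· (k :· y)) ⊜ g :⁻ :· (h :· y)) refl g h k y)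
              (·∈ H Hghkg Hgky)))
        (size-permute (mem? (g ∩ᶜ)) (translateʳ (k ⁻)))

-- p-groups with a unique subgroup of order p

-- The sum 1 + r + ⋯ + r^(j-1) in Horner form, the shape in which it arises when powers of xⁱy are
-- expanded.
geometric : ℕ → ℕ → ℕ
geometric r zero    = 0
geometric r (suc j) = 1 + r * geometric r j

-- The binomial coefficient j(j - 1)/2, defined without a division.
triangle : ℕ → ℕ
triangle zero    = 0
triangle (suc j) = triangle j + j

-- Modulo p² the power (1 + tp)^i is 1 + itp; summing over i < j gives the two leading terms, and
-- `e` collects the rest.
geometric-expansion : ∀ p t j → ∃[ e ] geometric (1 + t * p) j ≡ j + t * p * triangle j + p * p * e
geometric-expansion p t zero = 0 , solve 2 (λ p t → con 0 := con 0 :+ t :* p :* con 0 :+ p :* p :* con 0) refl p t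
  where open +-*-Solver
geometric-expansion p t (suc j) = let e , eq = geometric-expansion p t j in
  e + t * t * triangle j + t * p * e , trans (cong (λ g → 1 + (1 + t * p) * g) eq)
    (solve 5 (λ p t j T e →
      con 1 :+ (con 1 :+ t :* p) :* (j :+ t :* p :* T :+ p :* p :* e) :=
      con 1 :+ j :+ t :* p :* (T :+ j) :+ p :* p :* (e :+ t :* t :* T :+ t :* p :* e)) refl p t j (triangle j) e)
  where open +-*-Solver

triangle-odd : ∀ h → triangle (suc (2 * h)) ≡ h * suc (2 * h)
triangle-odd zero    = refl
triangle-odd (suc h) = begin
  triangle (suc (2 * suc h))                                  ≡⟨ cong (triangle ∘ suc) (*-suc 2 h) ⟩
  triangle (suc (2 * h)) + suc (2 * h) + suc (suc (2 * h))    ≡⟨ cong (λ T → T + suc (2 * h) + suc (suc (2 * h))) (triangle-odd h) ⟩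
  h * suc (2 * h) + suc (2 * h) + suc (suc (2 * h))           ≡⟨ solve 1 (λ h →
      h :* (con 1 :+ con 2 :* h) :+ (con 1 :+ con 2 :* h) :+ (con 2 :+ con 2 :* h) :=
      (con 1 :+ h) :* (con 1 :+ con 2 :* (con 1 :+ h))) refl h ⟩
  suc h * suc (2 * suc h)                                     ∎
  where
  open ≡-Reasoning
  open +-*-Solver

-- For odd p the coefficient p(p - 1)/2 is a multiple of p, so the middle term of the expansion
-- vanishes modulo p². For p = 2 this coefficient is 1, which is what leaves room for the quaternion
-- groups.
geometric-odd : ∀ p h t → p ≡ suc (2 * h) → ∃[ f ] geometric (1 + t * p) p ≡ p * (1 + p * f)
geometric-odd p h t p≡ = let e , eq = geometric-expansion p t p in t * h + e , (begin
  geometric (1 + t * p) p                ≡⟨ eq ⟩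
  p + t * p * triangle p + p * p * e     ≡⟨ cong (λ T → p + t * p * T + p * p * e) triangle-p ⟩
  p + t * p * (h * p) + p * p * e        ≡⟨ solve 4 (λ p t h e →
      p :+ t :* p :* (h :* p) :+ p :* p :* e := p :* (con 1 :+ p :* (t :* h :+ e))) refl p t h e ⟩
  p * (1 + p * (t * h + e))              ∎)
  where
  open ≡-Reasoning
  open +-*-Solver
  triangle-p : triangle p ≡ h * p
  triangle-p = trans (cong triangle p≡) (trans (triangle-odd h) (cong (h *_) (sym p≡)))

module PGroup (p : ℕ) (p-prime : Prime p) (G : FiniteGroup) (k : ℕ) (∣G∣≡p^k : order G ≡ p ^ k) where
  open PrimeArithmetic p p-prime
  open GroupTheory G
  open Subgroup using (Mem; mem?; 𝟙∈; ·∈; ⁻∈; card)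
  open ≡-Reasoning

  ∣G∣⇒≡1∨p∣ : ∀ {d} → d ∣ ∣G∣ → d ≡ 1 ⊎ p ∣ d
  ∣G∣⇒≡1∨p∣ d∣ = ∣^⇒≡1∨∣ k (subst (_ ∣_) ∣G∣≡p^k d∣)

  -- The index t divides the p-power |G|, so it is 1 or a multiple of p; the element a outside S
  -- excludes 1.
  p*card∣ : (S H : Subgroup) → Mem S ⊆ Mem H → ∀ {a} → Mem H a → ¬ Mem S a → ∃[ t ] card H ≡ t * card S × p ∣ t
  p*card∣ S H S⊆H {a} Ha ¬Sa with lagrange S H S⊆H
  ... | divides t card-H with ∣G∣⇒≡1∨p∣ (∣-trans (divides (card S) (trans card-H (*-comm t _))) (lagrange′ H))
  ...   | inj₂ p∣t = t , card-H , p∣t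
  ...   | inj₁ refl = contradiction (trans (sym card-H) (trans split refl)) λ eq →
            <⇒≢ (m<m+n (card S) (size-positive outside? (Ha , ¬Sa))) (trans (sym (*-identityˡ _)) eq)
    where
    outside? : Decidable (λ b → Mem H b × ¬ Mem S b)
    outside? b = mem? H b ×-dec ¬? (mem? S b)
    split : card H ≡ card S + size outside?
    split = size-⊆-split (mem? S) (mem? H) S⊆H

  -- If no element outside H normalised H, then all double cosets HgH other than H itself
  -- would have size divisible by p|H|, and hence so would |G| and |H|.
  normalizer-grows : (H : Subgroup) → ∀ {a} → ¬ Mem H a →
    ∃[ g ] ¬ Mem H g × (∀ {h} → Mem H h → Mem H (g ⁻ · (h · g)))
  normalizer-grows H {a} ¬Ha
    with any? (λ g → ¬? (mem? H g) ×-dec ¬? (any? (λ h → mem? H h ×-dec ¬? (mem? H (g ⁻ · (h · g))))))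
  ... | yes (g , ¬Hg , none) = g , ¬Hg , λ {h} Hh → decidable-stable (mem? H _) λ ¬H → none (h , Hh , ¬H)
  ... | no none = contradiction p*∣H∣∣∣H∣ (>⇒∤ (m<m*n (card H) p (nonTrivial⇒n>1 p)) ∘ subst (_∣ card H) (*-comm p _))
    where
    open Partition (doubleCosets H)
    instance _ = Subgroup.nonZero H
    class : ∀ {g} → ¬ Mem H g → p * card H ∣ size (g ~?_)
    class {g} ¬Hg with any? (λ h → mem? H h ×-dec ¬? (mem? H (g ⁻ · (h · g))))
    ... | no normal = contradiction (g , ¬Hg , normal) none
    -- Since g⁻¹hg escapes H, the subgroup S = H ∩ gHg⁻¹ is proper in H and its index t is a
    -- multiple of p. The identity |HgH| |S| = |H|² then gives |HgH| = t|H|.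
    ... | yes (h , Hh , ¬H) with p*card∣ S H proj₁ Hh (¬H ∘ proj₂)
      where
      S : Subgroup
      S = _∩ᶜ H g
    ...   | t , card-H , p∣t = subst (p * card H ∣_) (sym size-class) (*-monoˡ-∣ (card H) p∣t)
      where
      S : Subgroup
      S = _∩ᶜ H g
      instance _ = Subgroup.nonZero S
      size-class : size (g ~?_) ≡ t * card H
      size-class = *-cancelʳ-≡ _ _ (card S) (begin
        size (g ~?_) * card S  ≡⟨ card-doubleCoset H g ⟩
        card H * card H        ≡⟨ cong (_* card H) card-H ⟩
        t * card S * card H    ≡⟨ *-assoc t _ _ ⟩
        t * (card S * card H)  ≡⟨ cong (t *_) (*-comm (card S) _) ⟩
        t * (card H * card S)  ≡⟨ sym (*-assoc t _ _) ⟩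
        t * card H * card S    ∎)
    outside? : Decidable (λ b → (b ≡ b) × ¬ Mem H b)
    outside? b = mem? whole b ×-dec ¬? (mem? H b)
    p*∣H∣∣outside : p * card H ∣ size outside?
    p*∣H∣∣outside = ∣classes⇒∣size (doubleCosets H) outside? (p * card H)
      (λ {a} {b} (_ , ¬Ha) (h , Hh , Hahb) → refl , λ Hb → ¬Ha
        (subst (Mem H) (word-solve 3 (λ a b h → h :· b :· (a :⁻ :· (h :· b)) :⁻ ⊜ a) refl a b h)
          (·∈ H (·∈ H Hh Hb) (⁻∈ H Hahb))))
      (class ∘ proj₂)
    p*∣H∣∣whole : p * card H ∣ card whole
    p*∣H∣∣whole with t , eq , p∣t ← p*card∣ H whole (λ _ → refl) {a} refl ¬Ha =
      subst (p * card H ∣_) (sym eq) (*-monoˡ-∣ (card H) p∣t)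
    p*∣H∣∣∣H∣ : p * card H ∣ card H
    p*∣H∣∣∣H∣ = ∣m+n∣m⇒∣n (subst (p * card H ∣_)
      (trans (size-⊆-split (mem? H) (mem? whole) (λ _ → refl)) (+-comm (card H) _)) p*∣H∣∣whole) p*∣H∣∣outside

  -- Exponents prime to `p` and orders that are powers of `p`

  ↑p^k : ∀ g → g ↑ (p ^ k) ≡ 𝟙
  ↑p^k g = trans (cong (g ↑_) (sym ∣G∣≡p^k)) (↑order g)

  -- Bézout gives an inverse of u modulo p^k = |G|; one exponent serves all elements g at once.
  coprime-root : ∀ {u} → p ∤ u → ∃[ u′ ] ∀ g → g ↑ (u * u′) ≡ g
  coprime-root {u} p∤u with coprime-Bézout (∤⇒coprime-^ p∤u k)
  ... | Bézout.+- x y eq = x , λ g → begin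
    g ↑ (u * x)              ≡⟨ cong (g ↑_) (trans (*-comm u x) (sym eq)) ⟩
    g · g ↑ (y * p ^ k)      ≡⟨ cong (g ·_) (∣⇒↑≡𝟙 (↑p^k g) (n∣m*n y)) ⟩
    g · 𝟙                    ≡⟨ identityʳ g ⟩
    g                        ∎
  -- In this form of Bézout's identity 1 + xu = y p^k, so xu acts as -1 on exponents. Its square
  -- acts as 1, whence the root x(xu).
  ... | Bézout.-+ x y eq = x * (x * u) , λ g → begin
    g ↑ (u * (x * (x * u)))  ≡⟨ cong (g ↑_) (trans (sym (*-assoc u x _)) (cong (_* (x * u)) (*-comm u x))) ⟩
    g ↑ (x * u * (x * u))    ≡⟨ ↑-* g (x * u) (x * u) ⟩
    (g ↑ (x * u)) ↑ (x * u)  ≡⟨ ·-cancelˡ (g ↑ (x * u)) (trans (inverse (g ↑ (x * u))) (sym (trans (↑-comm-1 g) (inverse g)))) ⟩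
    g                        ∎
    where
    inverse : ∀ g → g · g ↑ (x * u) ≡ 𝟙
    inverse g = trans (cong (g ↑_) eq) (∣⇒↑≡𝟙 (↑p^k g) (n∣m*n y))
    ↑-comm-1 : ∀ g → g ↑ (x * u) · g ≡ g · g ↑ (x * u)
    ↑-comm-1 g = trans (cong (g ↑ (x * u) ·_) (sym (↑-1 g))) (trans (↑-comm g (x * u) 1) (cong (_· g ↑ (x * u)) (↑-1 g)))

  coprime-torsion : ∀ {u} → p ∤ u → ∀ {g} → g ↑ u ≡ 𝟙 → g ≡ 𝟙
  coprime-torsion {u} p∤u {g} g↑u≡𝟙 with u′ , root ← coprime-root p∤u =
    trans (sym (root g)) (∣⇒↑≡𝟙 {g} {u} {u * u′} g↑u≡𝟙 (m∣m*n u′))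

  -- An exponent prime to p would make x trivial; otherwise i/p annihilates x ↑ p, and induction on
  -- n applies to that element. Together with x^(p^(n+1)) = 1 this expresses that x has order
  -- p^(n+1).
  order-∣ : ∀ n {x i} → x ↑ (p ^ n) ≢ 𝟙 → x ↑ i ≡ 𝟙 → p ^ suc n ∣ i
  order-∣ n {x} {i} x≢ x↑i≡𝟙 with p ∣? i
  ... | no p∤i = contradiction (trans (cong (_↑ (p ^ n)) (coprime-torsion p∤i x↑i≡𝟙)) (𝟙↑ (p ^ n))) x≢
  order-∣ zero x≢ x↑i≡𝟙 | yes p∣i = subst (_∣ _) (sym (*-identityʳ p)) p∣i
  order-∣ (suc n) {x} x≢ x↑i≡𝟙 | yes (divides q refl) = subst (p ^ suc (suc n) ∣_) (*-comm p q)
    (*-monoʳ-∣ p (order-∣ n {x ↑ p} {q} (x≢ ∘ trans (↑-*′ x p (p ^ n))) (trans (sym (↑-* x q p)) x↑i≡𝟙)))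

  -- Walk along g, g^p, g^(p²), ... and stop just before the first entry into P. For the trivial
  -- subgroup this finds an element of order p; for ⟨x⟩ it finds an element outside whose pth power
  -- lies inside.
  last-outside : {P : C → Set} → Decidable P → ∀ j {g} → ¬ P g → P (g ↑ (p ^ j)) →
    ∃[ i ] ¬ P (g ↑ (p ^ i)) × P ((g ↑ (p ^ i)) ↑ p)
  last-outside {P} P? zero {g} ¬Pg Pg = contradiction (subst P (↑-1 g) Pg) ¬Pg
  last-outside {P} P? (suc j) {g} ¬Pg Pg↑ with P? (g ↑ p)
  ... | yes Pg↑p = 0 , ¬Pg ∘ subst P (↑-1 g) , subst P (cong (_↑ p) (sym (↑-1 g))) Pg↑p
  ... | no ¬Pg↑p with i , ¬P , P′ ← last-outside P? j ¬Pg↑p (subst P (↑-*′ g p (p ^ j)) Pg↑) =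
    suc i , ¬P ∘ subst P (↑-*′ g p (p ^ i)) , subst P (cong (_↑ p) (sym (↑-*′ g p (p ^ i)))) P′

  order-p-power : ∀ {z} → z ≢ 𝟙 → ∃[ a ] z ↑ (p ^ a) ≢ 𝟙 × (z ↑ (p ^ a)) ↑ p ≡ 𝟙
  order-p-power {z} z≢𝟙 = last-outside {P = _≡ 𝟙} (_≟ 𝟙) k z≢𝟙 (↑p^k z)

  p-torsion-power : ∀ a {z} → z ↑ (p ^ a) ≢ 𝟙 → ∀ i → (z ↑ i) ↑ p ≡ 𝟙 → p ^ a ∣ i
  p-torsion-power a {z} t≢𝟙 i eq = *-cancelˡ-∣ p (order-∣ a t≢𝟙 (trans (↑-* z p i) eq))

  power-of-power : ∀ {t u} v → t ↑ p ≡ 𝟙 → t ↑ u ≢ 𝟙 → ∃[ l ] (t ↑ u) ↑ l ≡ t ↑ v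
  power-of-power {t} {u} v tᵖ≡𝟙 tᵘ≢𝟙 with coprime-root {u} (λ p∣u → tᵘ≢𝟙 (∣⇒↑≡𝟙 {t} {p} {u} tᵖ≡𝟙 p∣u))
  ... | u′ , root = u′ * v , (begin
    (t ↑ u) ↑ (u′ * v)   ≡⟨ sym (↑-*′ t u (u′ * v)) ⟩
    t ↑ (u * (u′ * v))   ≡⟨ cong (t ↑_) (sym (*-assoc u u′ v)) ⟩
    t ↑ (u * u′ * v)     ≡⟨ ↑-*′ t (u * u′) v ⟩
    (t ↑ (u * u′)) ↑ v   ≡⟨ cong (_↑ v) (root t) ⟩
    t ↑ v                ∎)

  -- A cyclic p-group has only one subgroup of order p: if t = z^(p^a) has order p, every p-torsion
  -- power of z is a power of t, and each nontrivial power of t generates ⟨t⟩.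
  same-order-p-subgroup : ∀ {z} i j → (z ↑ i) ↑ p ≡ 𝟙 → (z ↑ j) ↑ p ≡ 𝟙 → z ↑ i ≢ 𝟙 → ∃[ l ] (z ↑ i) ↑ l ≡ z ↑ j
  same-order-p-subgroup {z} i j wᵖ≡𝟙 cᵖ≡𝟙 w≢𝟙 =
    let a , t≢𝟙 , tᵖ≡𝟙 = order-p-power {z} (λ z≡𝟙 → w≢𝟙 (trans (cong (_↑ i) z≡𝟙) (𝟙↑ i)))
    in generated a tᵖ≡𝟙 (p-torsion-power a t≢𝟙 i wᵖ≡𝟙) (p-torsion-power a t≢𝟙 j cᵖ≡𝟙)
    where
    generated : ∀ a → (z ↑ (p ^ a)) ↑ p ≡ 𝟙 → p ^ a ∣ i → p ^ a ∣ j → ∃[ l ] (z ↑ i) ↑ l ≡ z ↑ j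
    generated a tᵖ≡𝟙 (divides u i≡) (divides v j≡) = l , (begin
      (z ↑ i) ↑ l                ≡⟨ cong (_↑ l) w≡ ⟩
      ((z ↑ (p ^ a)) ↑ u) ↑ l    ≡⟨ eq ⟩
      (z ↑ (p ^ a)) ↑ v          ≡⟨ sym (↑-* z v (p ^ a)) ⟩
      z ↑ (v * p ^ a)            ≡⟨ cong (z ↑_) (sym j≡) ⟩
      z ↑ j                      ∎)
      where
      w≡ : z ↑ i ≡ (z ↑ (p ^ a)) ↑ u
      w≡ = trans (cong (z ↑_) i≡) (↑-* z u (p ^ a))
      generator : ∃[ l ] ((z ↑ (p ^ a)) ↑ u) ↑ l ≡ (z ↑ (p ^ a)) ↑ v
      generator = power-of-power {z ↑ (p ^ a)} {u} v tᵖ≡𝟙 (w≢𝟙 ∘ trans w≡)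
      l : ℕ
      l = proj₁ generator
      eq : ((z ↑ (p ^ a)) ↑ u) ↑ l ≡ (z ↑ (p ^ a)) ↑ v
      eq = proj₂ generator

  -- The first hypotheses say that x has order p^(n+1) and that no element has a larger order; the
  -- last two make the subgroup generated by x^(pⁿ) central and the only one of order p.
  module Exponent (n : ℕ) (exponent : ∀ g → g ↑ (p ^ suc n) ≡ 𝟙)
    (x : C) (x₀≢𝟙 : x ↑ (p ^ n) ≢ 𝟙) (x₀-central : ∀ g → g · x ↑ (p ^ n) ≡ x ↑ (p ^ n) · g)
    (unique : ∀ {w} → w ↑ p ≡ 𝟙 → ∃[ i ] (x ↑ (p ^ n)) ↑ i ≡ w) where

    x₀ : C
    x₀ = x ↑ (p ^ n)

    instance
      q-nonZero : NonZero (p ^ suc n)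
      q-nonZero = m^n≢0 p (suc n)

    ⟨x⟩ : Subgroup
    ⟨x⟩ = cyclic x (p ^ suc n) (exponent x)

    x-period : ∀ {i} → x ↑ i ≡ 𝟙 → p ^ suc n ∣ i
    x-period = order-∣ n x₀≢𝟙

    p-torsion∈⟨x⟩ : ∀ {w} → w ↑ p ≡ 𝟙 → Mem ⟨x⟩ w
    p-torsion∈⟨x⟩ wᵖ≡𝟙 = let i , eq = unique wᵖ≡𝟙 in i * p ^ n , trans (↑-* x i (p ^ n)) eq

    -- That is, yxy⁻¹ = x^r. As a record type it displays r, which could not be read off from
    -- `x ↑ r` by unification.
    record Twists (y : C) (r : ℕ) : Set where
      constructor twists
      field conjugates : y · x ≡ x ↑ r · y
    open Twists

    twists-↑ : ∀ {y r} → Twists y r → ∀ i → y · x ↑ i ≡ x ↑ (r * i) · y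
    twists-↑ {y} {r} twist zero = trans (trans (identityʳ y) (sym (identityˡ y))) (cong (λ j → x ↑ j · y) (sym (*-zeroʳ r)))
    twists-↑ {y} {r} twist (suc i) = begin
      y · (x · x ↑ i)              ≡⟨ sym (assoc _ _ _) ⟩
      y · x · x ↑ i                ≡⟨ cong (_· x ↑ i) (conjugates twist) ⟩
      x ↑ r · y · x ↑ i            ≡⟨ assoc _ _ _ ⟩
      x ↑ r · (y · x ↑ i)          ≡⟨ cong (x ↑ r ·_) (twists-↑ twist i) ⟩
      x ↑ r · (x ↑ (r * i) · y)    ≡⟨ sym (assoc _ _ _) ⟩
      x ↑ r · x ↑ (r * i) · y      ≡⟨ cong (_· y) (sym (↑-+ x r (r * i))) ⟩
      x ↑ (r + r * i) · y          ≡⟨ cong (λ j → x ↑ j · y) (sym (*-suc r i)) ⟩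
      x ↑ (r * suc i) · y          ∎

    twists-· : ∀ {y z r s} → Twists y r → Twists z s → Twists (y · z) (r * s)
    twists-· {y} {z} {r} {s} y-twist z-twist = twists (begin
      y · z · x              ≡⟨ assoc _ _ _ ⟩
      y · (z · x)            ≡⟨ cong (y ·_) (conjugates z-twist) ⟩
      y · (x ↑ s · z)        ≡⟨ sym (assoc _ _ _) ⟩
      y · x ↑ s · z          ≡⟨ cong (_· z) (twists-↑ y-twist s) ⟩
      x ↑ (r * s) · y · z    ≡⟨ assoc _ _ _ ⟩
      x ↑ (r * s) · (y · z)  ∎)

    -- Moving all copies of y to the right multiplies the successive exponents i by 1, r, ...,
    -- r^(j-1).
    [xⁱy]ʲ : ∀ {y r} → Twists y r → ∀ i j → (x ↑ i · y) ↑ j ≡ x ↑ (i * geometric r j) · y ↑ j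
    [xⁱy]ʲ {y} {r} twist i zero = sym (trans (identityʳ _) (cong (x ↑_) (*-zeroʳ i)))
    [xⁱy]ʲ {y} {r} twist i (suc j) = begin
      x ↑ i · y · (x ↑ i · y) ↑ j                  ≡⟨ cong (x ↑ i · y ·_) ([xⁱy]ʲ twist i j) ⟩
      x ↑ i · y · (x ↑ (i * g) · y ↑ j)            ≡⟨ word-solve 4 (λ a y b c → a :· y :· (b :· c) ⊜ a :· (y :· b) :· c) refl (x ↑ i) y (x ↑ (i * g)) (y ↑ j) ⟩
      x ↑ i · (y · x ↑ (i * g)) · y ↑ j            ≡⟨ cong (λ a → x ↑ i · a · y ↑ j) (twists-↑ twist (i * g)) ⟩
      x ↑ i · (x ↑ (r * (i * g)) · y) · y ↑ j      ≡⟨ word-solve 4 (λ a b y c → a :· (b :· y) :· c ⊜ a :· b :· (y :· c)) refl (x ↑ i) (x ↑ (r * (i * g))) y (y ↑ j) ⟩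
      x ↑ i · x ↑ (r * (i * g)) · (y · y ↑ j)      ≡⟨ cong (_· (y · y ↑ j)) (sym (↑-+ x i _)) ⟩
      x ↑ (i + r * (i * g)) · (y · y ↑ j)          ≡⟨ cong (λ e → x ↑ e · (y · y ↑ j)) (solve 3 (λ i r g → i :+ r :* (i :* g) := i :* (con 1 :+ r :* g)) refl i r g) ⟩
      x ↑ (i * (1 + r * g)) · (y · y ↑ j)          ∎
      where
      g : ℕ
      g = geometric r j
      open +-*-Solver

    -- Conjugation by y fixes the central x₀ and also raises it to the power r; as x₀ has order p,
    -- this gives p ∣ r - 1. The case r = 0, which would make x trivial, is split off so that r - 1
    -- is a natural number.
    twist≡1 : ∀ {y r} → Twists y r → ∃[ t ] r ≡ 1 + t * p
    twist≡1 {y} {zero}  twist = contradiction (trans (cong (_↑ (p ^ n)) x≡𝟙) (𝟙↑ (p ^ n))) x₀≢𝟙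
      where
      x≡𝟙 : x ≡ 𝟙
      x≡𝟙 = ·-cancelˡ y (trans (conjugates twist) (trans (identityˡ y) (sym (identityʳ y))))
    twist≡1 {y} {suc r} twist = quotient p∣r , cong suc (m∣n⇒n≡quotient*m p∣r)
      where
      x₀≡x₀·x₀ʳ : x₀ · 𝟙 ≡ x₀ · x ↑ (r * p ^ n)
      x₀≡x₀·x₀ʳ = ·-cancelʳ y (begin
        x₀ · 𝟙 · y                    ≡⟨ cong (_· y) (identityʳ x₀) ⟩
        x₀ · y                        ≡⟨ sym (x₀-central y) ⟩
        y · x₀                        ≡⟨ twists-↑ twist (p ^ n) ⟩
        x ↑ (p ^ n + r * p ^ n) · y   ≡⟨ cong (_· y) (↑-+ x (p ^ n) _) ⟩
        x₀ · x ↑ (r * p ^ n) · y      ∎)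
      p∣r : p ∣ r
      p∣r = *-cancelʳ-∣ (p ^ n) {{m^n≢0 p n}} (x-period {r * p ^ n} (sym (·-cancelˡ x₀ x₀≡x₀·x₀ʳ)))

    xⁱy∉⟨x⟩ : ∀ {y} → ¬ Mem ⟨x⟩ y → ∀ i → ¬ Mem ⟨x⟩ (x ↑ i · y)
    xⁱy∉⟨x⟩ {y} y∉ i xⁱy∈ = y∉ (subst (Mem ⟨x⟩) (word-solve 2 (λ a y → a :⁻ :· (a :· y) ⊜ y) refl (x ↑ i) y)
      (·∈ ⟨x⟩ (⁻∈ ⟨x⟩ (i , refl)) xⁱy∈))

    -- Otherwise s is invertible and x is a power of yᵖ; then x^(pⁿ) is a power of y^(p^(n+1)) = 1.
    -- The maximality of the order of x enters here.
    pth-power-exponent : ∀ {y s} → x ↑ s ≡ y ↑ p → p ∣ s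
    pth-power-exponent {y} {s} eq = decidable-stable (p ∣? s) λ p∤s → let s′ , root = coprime-root p∤s in
      x₀≢𝟙 (begin
        x ↑ (p ^ n)                     ≡⟨ cong (_↑ (p ^ n)) (sym (root x)) ⟩
        (x ↑ (s * s′)) ↑ (p ^ n)        ≡⟨ cong (_↑ (p ^ n)) (trans (↑-*′ x s s′) (cong (_↑ s′) eq)) ⟩
        ((y ↑ p) ↑ s′) ↑ (p ^ n)        ≡⟨ sym (trans (↑-*′ y p (s′ * p ^ n)) (↑-*′ (y ↑ p) s′ (p ^ n))) ⟩
        y ↑ (p * (s′ * p ^ n))          ≡⟨ cong (y ↑_) (solve 3 (λ p s q → p :* (s :* q) := s :* (p :* q)) refl p s′ (p ^ n)) ⟩
        y ↑ (s′ * p ^ suc n)            ≡⟨ ∣⇒↑≡𝟙 {y} {p ^ suc n} {s′ * p ^ suc n} (exponent y) (n∣m*n s′) ⟩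
        𝟙                               ∎)
      where open +-*-Solver

    -- Otherwise some element xⁱy would have order p.
    geometric-not-p*unit : ∀ {y r} → ¬ Mem ⟨x⟩ y → Twists y r → Mem ⟨x⟩ (y ↑ p) → ∀ u → geometric r p ≡ p * u → p ∣ u
    geometric-not-p*unit {y} {r} y∉ twist (s , xˢ≡yᵖ) u geometric≡ =
      decidable-stable (p ∣? u) λ p∤u → let u′ , root = coprime-root p∤u in torsion u′ root (pth-power-exponent {y} {s} xˢ≡yᵖ)
      where
      open +-*-Solver
      q = p ^ suc n
      torsion : ∀ u′ → (∀ g → g ↑ (u * u′) ≡ g) → ¬ (p ∣ s)
      torsion u′ root (divides s′ s≡) = xⁱy∉⟨x⟩ y∉ i (p-torsion∈⟨x⟩ (begin
        (x ↑ i · y) ↑ p                                ≡⟨ [xⁱy]ʲ twist i p ⟩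
        x ↑ (i * geometric r p) · y ↑ p                ≡⟨ cong₂ (λ e a → x ↑ e · a) exponent≡ (trans (sym xˢ≡yᵖ) (cong (x ↑_) s≡)) ⟩
        x ↑ (u * u′ * (s′ * p * pred q)) · x ↑ (s′ * p) ≡⟨ cong (_· x ↑ (s′ * p)) (trans (↑-*′ x (u * u′) _) (cong (_↑ (s′ * p * pred q)) (root x))) ⟩
        x ↑ (s′ * p * pred q) · x ↑ (s′ * p)           ≡⟨ sym (↑-+ x (s′ * p * pred q) (s′ * p)) ⟩
        x ↑ (s′ * p * pred q + s′ * p)                 ≡⟨ cong (x ↑_) (trans (+-comm _ (s′ * p)) (sym (*-suc (s′ * p) (pred q)))) ⟩
        x ↑ (s′ * p * suc (pred q))                    ≡⟨ cong (λ e → x ↑ (s′ * p * e)) (suc-pred q) ⟩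
        x ↑ (s′ * p * q)                               ≡⟨ ∣⇒↑≡𝟙 {x} {q} {s′ * p * q} (exponent x) (n∣m*n (s′ * p)) ⟩
        𝟙                                              ∎))
        where
        -- Chosen so that i · pu ≡ -s modulo q, where s = s′p: u′ inverts u, and `pred q` acts as
        -- -1.
        i : ℕ
        i = u′ * (s′ * pred q)
        exponent≡ : i * geometric r p ≡ u * u′ * (s′ * p * pred q)
        exponent≡ = trans (cong (i *_) geometric≡)
          (solve 5 (λ u u′ s p q → u′ :* (s :* q) :* (p :* u) := u :* u′ :* (s :* p :* q)) refl u u′ s′ p (pred q))

    odd⇒twist-free : ∀ {h} → p ≡ suc (2 * h) → ∀ {y r} → ¬ Mem ⟨x⟩ y → Twists y r → ¬ Mem ⟨x⟩ (y ↑ p)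
    odd⇒twist-free {h} p≡ {y} {r} y∉ twist yᵖ∈ =
      let t , r≡  = twist≡1 twist
          f , eq  = geometric-odd p h t p≡
          p∣1+pf  = geometric-not-p*unit y∉ twist yᵖ∈ (1 + p * f) (trans (cong (λ r → geometric r p) r≡) eq)
      in nonTrivial⇒≢1 (∣1⇒≡1 (∣m+n∣m⇒∣n (subst (p ∣_) (+-comm 1 (p * f)) p∣1+pf) (m∣m*n f)))

    normalizing⇒twists : ∀ {y} → Mem ⟨x⟩ (y · x · y ⁻) → ∃[ r ] Twists y r
    normalizing⇒twists {y} (r , eq) = r , twists (trans (word-solve 2 (λ y x → y :· x ⊜ y :· x :· y :⁻ :· y) refl y x) (cong (_· y) (sym eq)))

    twists-power : ∀ {y r} → Twists y r → ∀ i → ∃[ s ] Twists (y ↑ i) s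
    twists-power twist zero    = 1 , twists (trans (identityˡ x) (sym (trans (identityʳ _) (identityʳ x))))
    twists-power {y} {r} twist (suc i) = let s , twist′ = twists-power twist i in r * s , twists-· twist twist′

    -- Normalizer growth speaks of g⁻¹hg, so it is g⁻¹ that twists x. All its powers twist x as
    -- well, and the chain of its p-power powers passes through an element outside ⟨x⟩ whose pth
    -- power lies inside.
    ∃-twisting : ∀ {a} → ¬ Mem ⟨x⟩ a → ∃[ y ] ∃[ r ] ¬ Mem ⟨x⟩ y × Twists y r × Mem ⟨x⟩ (y ↑ p)
    ∃-twisting a∉ =
      let g , g∉ , normal = normalizer-grows ⟨x⟩ a∉
          r , twist       = normalizing⇒twists {g ⁻} (subst (Mem ⟨x⟩)
                              (word-solve 2 (λ g x → g :⁻ :· (x :· g) ⊜ g :⁻ :· x :· g :⁻ :⁻) refl g x) (normal (1 , ↑-1 x)))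
          i , y∉ , yᵖ∈    = last-outside (mem? ⟨x⟩) k {g ⁻} (λ g⁻∈ → g∉ (subst (Mem ⟨x⟩) (word-solve 1 (λ g → g :⁻ :⁻ ⊜ g) refl g) (⁻∈ ⟨x⟩ g⁻∈)))
                              (subst (Mem ⟨x⟩) (sym (↑p^k (g ⁻))) (𝟙∈ ⟨x⟩))
          s , twist′      = twists-power twist (p ^ i)
      in (g ⁻) ↑ (p ^ i) , s , y∉ , twist′ , yᵖ∈

    odd⇒cyclic : ∀ {h} → p ≡ suc (2 * h) → ∀ a → Mem ⟨x⟩ a
    odd⇒cyclic {h} p≡ a = decidable-stable (mem? ⟨x⟩ a) λ a∉ →
      let y , r , y∉ , twist , yᵖ∈ = ∃-twisting a∉ in odd⇒twist-free {h} p≡ y∉ twist yᵖ∈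

-- 2-groups with a unique involution

parity : ∀ m → ∃[ h ] (m ≡ 2 * h ⊎ m ≡ suc (2 * h))
parity zero    = 0 , inj₁ refl
parity (suc m) with parity m
... | h , inj₁ refl = h , inj₂ refl
... | h , inj₂ refl = suc h , inj₁ (sym (*-suc 2 h))

-- Squares are 0 or 1 modulo 4. Consequently no element that twists x can have a square inverting x
-- once 4 divides the order of x.
4∤1+r² : ∀ r → 4 ∤ 1 + r * r
4∤1+r² r 4∣ with parity r
... | h , inj₁ refl = >⇒∤ (s≤s (s≤s z≤n)) (∣m+n∣m⇒∣n
  (subst (4 ∣_) (solve 1 (λ h → con 1 :+ con 2 :* h :* (con 2 :* h) := con 4 :* (h :* h) :+ con 1) refl h) 4∣) (m∣m*n (h * h)))
  where open +-*-Solver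
... | h , inj₂ refl = >⇒∤ (s≤s (s≤s (s≤s z≤n))) (∣m+n∣m⇒∣n
  (subst (4 ∣_) (solve 1 (λ h → con 1 :+ (con 1 :+ con 2 :* h) :* (con 1 :+ con 2 :* h) := con 4 :* (h :* h :+ h) :+ con 2) refl h) 4∣)
  (m∣m*n (h * h + h)))
  where open +-*-Solver

odd-square : ∀ t → suc ((suc (1 + 2 * t) + suc (1 + 2 * t)) * t) ≡ (1 + 2 * t) * (1 + 2 * t)
odd-square = solve 1 (λ t → con 1 :+ ((con 2 :+ con 2 :* t) :+ (con 2 :+ con 2 :* t)) :* t :=
  (con 1 :+ con 2 :* t) :* (con 1 :+ con 2 :* t)) refl
  where open +-*-Solver

module TwoGroup (G : FiniteGroup) (k : ℕ) (∣G∣≡2^k : order G ≡ 2 ^ k) where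
  open PGroup 2 prime[2] G k ∣G∣≡2^k
  open GroupTheory G
  open Subgroup using (Mem; mem?; 𝟙∈; ·∈; ⁻∈)
  open ≡-Reasoning

  module UniqueInvolution (n : ℕ) (exponent : ∀ g → g ↑ (2 ^ suc n) ≡ 𝟙)
    (x : C) (x₀≢𝟙 : x ↑ (2 ^ n) ≢ 𝟙) (x₀-central : ∀ g → g · x ↑ (2 ^ n) ≡ x ↑ (2 ^ n) · g)
    (unique : ∀ {w} → w ↑ 2 ≡ 𝟙 → ∃[ i ] (x ↑ (2 ^ n)) ↑ i ≡ w) where

    open Exponent n exponent x x₀≢𝟙 x₀-central unique public
    open Twists

    x₀↑2 : x₀ ↑ 2 ≡ 𝟙
    x₀↑2 = trans (sym (↑-* x 2 (2 ^ n))) (exponent x)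

    involution : ∀ {w} → w · w ≡ 𝟙 → w ≡ 𝟙 ⊎ w ≡ x₀
    involution {w} w²≡𝟙 = let i , eq = unique (trans (↑-2 w) w²≡𝟙) ; h , cases = parity i in Sum.map
      (λ i≡ → trans (sym eq) (∣⇒↑≡𝟙 {x₀} {2} {i} x₀↑2 (divides h (trans i≡ (*-comm 2 h)))))
      (λ i≡ → trans (sym eq) (trans (cong (x₀ ↑_) i≡)
        (trans (cong (x₀ ·_) (∣⇒↑≡𝟙 {x₀} {2} {2 * h} x₀↑2 (m∣m*n h))) (identityʳ x₀))))
      cases

    involution-≢x₀ : ∀ {w} → w · w ≡ 𝟙 → w ≢ x₀ → w ≡ 𝟙
    involution-≢x₀ w²≡𝟙 w≢x₀ = [ (λ eq → eq) , (λ eq → contradiction eq w≢x₀) ]′ (involution w²≡𝟙)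

    involution-≢𝟙 : ∀ {w} → w · w ≡ 𝟙 → w ≢ 𝟙 → w ≡ x₀
    involution-≢𝟙 w²≡𝟙 w≢𝟙 = [ (λ eq → contradiction eq w≢𝟙) , (λ eq → eq) ]′ (involution w²≡𝟙)

    x₀² : x₀ · x₀ ≡ 𝟙
    x₀² = trans (sym (↑-2 x₀)) x₀↑2

    involution∈ : ∀ {w} → w · w ≡ 𝟙 → Mem ⟨x⟩ w
    involution∈ {w} w²≡𝟙 = p-torsion∈⟨x⟩ (trans (↑-2 w) w²≡𝟙)

    Inverts : C → Set
    Inverts g = g · x ≡ x ⁻ · g

    twists⇒inverts : ∀ {y r} → Twists y r → x ↑ suc r ≡ 𝟙 → Inverts y
    twists⇒inverts {y} {r} twist eq = trans (conjugates twist) (cong (_· y)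
      (trans (word-solve 2 (λ x a → a ⊜ x :⁻ :· (x :· a)) refl x (x ↑ r)) (trans (cong (x ⁻ ·_) eq) (identityʳ _))))

    -- For p = 2 the geometric sum is 1 + r = 2(1 + t). If 1 + t were odd, some xⁱy would be an
    -- involution outside ⟨x⟩; hence r ≡ 3 mod 4.
    twist-odd : ∀ {y r} → ¬ Mem ⟨x⟩ y → Twists y r → Mem ⟨x⟩ (y · y) → ∃[ t ] r ≡ 1 + 2 * t × 2 ∤ t
    twist-odd {y} {r} y∉ twist y²∈ =
      let t , r≡ = twist≡1 twist
          2∣1+t  = geometric-not-p*unit y∉ twist (subst (Mem ⟨x⟩) (sym (↑-2 y)) y²∈) (1 + t)
                     (trans (cong (λ r → geometric r 2) r≡) (geometric-2 t))
      in t , trans r≡ (cong suc (*-comm t 2)) , λ 2∣t → >⇒∤ (s≤s (s≤s z≤n)) (∣m+n∣m⇒∣n (subst (2 ∣_) (+-comm 1 t) 2∣1+t) 2∣t)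
      where
      open +-*-Solver
      geometric-2 : ∀ t → geometric (1 + t * 2) 2 ≡ 2 * (1 + t)
      geometric-2 = solve 1 (λ t → con 1 :+ (con 1 :+ t :* con 2) :* (con 1 :+ (con 1 :+ t :* con 2) :* con 0) := con 2 :* (con 1 :+ t)) refl

    -- As y commutes with y² = xˢ, one gets x^(2ts) = 1, and t odd yields y⁴ = 1; so y² is the
    -- involution x₀. As y² commutes with x, also x^(r²) = x, so e = x^(r+1) has e² = 1. If e were
    -- x₀, then (xy)² = e x₀ = 1 would put xy into ⟨x⟩; hence e = 1 and r acts as -1.
    square-in⟨x⟩ : ∀ {y r} → ¬ Mem ⟨x⟩ y → Twists y r → Mem ⟨x⟩ (y · y) → Inverts y × y · y ≡ x₀
    square-in⟨x⟩ {y} {r} y∉ twist (s , xˢ≡y²) = go (twist-odd y∉ twist (s , xˢ≡y²))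
      where
      open +-*-Solver
      go : ∃[ t ] r ≡ 1 + 2 * t × 2 ∤ t → Inverts y × y · y ≡ x₀
      go (t , r≡ , 2∤t) = twists⇒inverts twist e≡𝟙 , y²≡x₀
        where
        x^[2ts]≡𝟙 : x ↑ (2 * t * s) ≡ 𝟙
        x^[2ts]≡𝟙 = sym (·-cancelˡ (x ↑ s) (·-cancelʳ y (begin
          x ↑ s · 𝟙 · y                 ≡⟨ cong (_· y) (trans (identityʳ _) xˢ≡y²) ⟩
          y · y · y                     ≡⟨ assoc y y y ⟩
          y · (y · y)                   ≡⟨ cong (y ·_) (sym xˢ≡y²) ⟩
          y · x ↑ s                     ≡⟨ twists-↑ twist s ⟩
          x ↑ (r * s) · y               ≡⟨ cong (λ r → x ↑ (r * s) · y) r≡ ⟩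
          x ↑ (s + 2 * t * s) · y       ≡⟨ cong (_· y) (↑-+ x s (2 * t * s)) ⟩
          x ↑ s · x ↑ (2 * t * s) · y   ∎)))
        y⁴≡𝟙 : y · y · (y · y) ≡ 𝟙
        y⁴≡𝟙 = coprime-torsion 2∤t {y · y · (y · y)} (begin
          (y · y · (y · y)) ↑ t   ≡⟨ cong (λ a → (a · a) ↑ t) (sym xˢ≡y²) ⟩
          (x ↑ s · x ↑ s) ↑ t     ≡⟨ cong (_↑ t) (sym (↑-+ x s s)) ⟩
          (x ↑ (s + s)) ↑ t       ≡⟨ sym (↑-*′ x (s + s) t) ⟩
          x ↑ ((s + s) * t)       ≡⟨ cong (x ↑_) (solve 2 (λ s t → (s :+ s) :* t := con 2 :* t :* s) refl s t) ⟩
          x ↑ (2 * t * s)         ≡⟨ x^[2ts]≡𝟙 ⟩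
          𝟙                       ∎)
        y²≡x₀ : y · y ≡ x₀
        y²≡x₀ = involution-≢𝟙 y⁴≡𝟙 (y∉ ∘ involution∈)
        e : C
        e = x ↑ suc r
        x^r²≡x : x ↑ (r * r) ≡ x
        x^r²≡x = ·-cancelʳ (y · y) (begin
          x ↑ (r * r) · (y · y)   ≡⟨ sym (conjugates (twists-· twist twist)) ⟩
          y · y · x               ≡⟨ cong₂ _·_ (sym xˢ≡y²) (sym (↑-1 x)) ⟩
          x ↑ s · x ↑ 1           ≡⟨ ↑-comm x s 1 ⟩
          x ↑ 1 · x ↑ s           ≡⟨ cong₂ _·_ (↑-1 x) xˢ≡y² ⟩
          x · (y · y)             ∎)
        -- r² − 1 = t · 2(r + 1) with t odd.
        e²≡𝟙 : e · e ≡ 𝟙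
        e²≡𝟙 = coprime-torsion 2∤t {e · e} (·-cancelˡ x (begin
          x · (e · e) ↑ t                      ≡⟨ cong (λ a → x · a ↑ t) (sym (↑-+ x (suc r) (suc r))) ⟩
          x · (x ↑ (suc r + suc r)) ↑ t        ≡⟨ cong (x ·_) (sym (↑-*′ x (suc r + suc r) t)) ⟩
          x ↑ suc ((suc r + suc r) * t)        ≡⟨ cong (λ r → x ↑ suc ((suc r + suc r) * t)) r≡ ⟩
          x ↑ suc ((suc (1 + 2 * t) + suc (1 + 2 * t)) * t) ≡⟨ cong (x ↑_) (odd-square t) ⟩
          x ↑ ((1 + 2 * t) * (1 + 2 * t))      ≡⟨ cong (λ r → x ↑ (r * r)) (sym r≡) ⟩
          x ↑ (r * r)                          ≡⟨ x^r²≡x ⟩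
          x                                    ≡⟨ sym (identityʳ x) ⟩
          x · 𝟙                                ∎))
        [xy]²≡ex₀ : x · y · (x · y) ≡ e · x₀
        [xy]²≡ex₀ = begin
          x · y · (x · y)         ≡⟨ word-solve 2 (λ x y → x :· y :· (x :· y) ⊜ x :· (y :· x) :· y) refl x y ⟩
          x · (y · x) · y         ≡⟨ cong (λ a → x · a · y) (conjugates twist) ⟩
          x · (x ↑ r · y) · y     ≡⟨ word-solve 3 (λ x a y → x :· (a :· y) :· y ⊜ x :· a :· (y :· y)) refl x (x ↑ r) y ⟩
          x · x ↑ r · (y · y)     ≡⟨ cong (e ·_) y²≡x₀ ⟩
          e · x₀                  ∎
        e≡𝟙 : e ≡ 𝟙
        e≡𝟙 = involution-≢x₀ e²≡𝟙 λ e≡x₀ → xⁱy∉⟨x⟩ y∉ 1 (subst (λ a → Mem ⟨x⟩ (a · y)) (sym (↑-1 x))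
          (involution∈ (trans [xy]²≡ex₀ (trans (cong (_· x₀) e≡x₀) x₀²))))

    module Noncyclic {a : C} (a∉ : ¬ Mem ⟨x⟩ a) where

      ∃-inverting : ∃[ y ] ¬ Mem ⟨x⟩ y × Inverts y × y · y ≡ x₀
      ∃-inverting = let y , r , y∉ , twist , y²∈ = ∃-twisting a∉
                    in y , y∉ , square-in⟨x⟩ y∉ twist (subst (Mem ⟨x⟩) (↑-2 y) y²∈)

      y : C
      y = proj₁ ∃-inverting

      y∉ : ¬ Mem ⟨x⟩ y
      y∉ = proj₁ (proj₂ ∃-inverting)

      y-inverts : Inverts y
      y-inverts = proj₁ (proj₂ (proj₂ ∃-inverting))

      y² : y · y ≡ x₀
      y² = proj₂ (proj₂ (proj₂ ∃-inverting))

      -- Exponent 2 would make y² = x₀ trivial. So x has order at least 4, which separates inverting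
      -- x from commuting with it.
      n≢0 : n ≢ 0
      n≢0 n≡0 = x₀≢𝟙 (trans (sym y²) (trans (sym (↑-2 y)) (subst (λ n → y ↑ (2 ^ suc n) ≡ 𝟙) n≡0 (exponent y))))

      ∃-pred : ∃[ m ] n ≡ suc m
      ∃-pred = pred n , sym (suc-pred n {{≢-nonZero n≢0}})

      4∣2^1+n : 4 ∣ 2 ^ suc n
      4∣2^1+n = let m , n≡ = ∃-pred in divides (2 ^ m) (trans (cong (λ n → 2 * 2 ^ n) n≡)
        (solve 1 (λ q → con 2 :* (con 2 :* q) := q :* con 4) refl (2 ^ m)))
        where open +-*-Solver

      x-order : ∀ {i} → x ↑ i ≡ 𝟙 → 4 ∣ i
      x-order {i} eq = ∣-trans 4∣2^1+n (x-period {i} eq)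

      x²≢𝟙 : x · x ≢ 𝟙
      x²≢𝟙 x²≡𝟙 = >⇒∤ (s≤s (s≤s (s≤s z≤n))) (x-order {2} (trans (↑-2 x) x²≡𝟙))

      ¬inverts∧commutes : ∀ {g} → Inverts g → g · x ≢ x · g
      ¬inverts∧commutes {g} inverts commutes = x²≢𝟙 (begin
        x · x      ≡⟨ cong (x ·_) (·-cancelʳ g (trans (sym commutes) inverts)) ⟩
        x · x ⁻    ≡⟨ inverseʳ x ⟩
        𝟙          ∎)

      inverts-² : ∀ {g h} → Inverts g → Inverts h → g · h · x ≡ x · (g · h)
      inverts-² {g} {h} g-inverts h-inverts = begin
        g · h · x                    ≡⟨ assoc g h x ⟩
        g · (h · x)                  ≡⟨ cong (g ·_) h-inverts ⟩
        g · (x ⁻ · h)                ≡⟨ word-solve 3 (λ g x h → g :· (x :⁻ :· h) ⊜ x :· (x :⁻ :· g) :· x :⁻ :· h) refl g x h ⟩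
        x · (x ⁻ · g) · x ⁻ · h      ≡⟨ cong (λ a → x · a · x ⁻ · h) (sym g-inverts) ⟩
        x · (g · x) · x ⁻ · h        ≡⟨ word-solve 3 (λ g x h → x :· (g :· x) :· x :⁻ :· h ⊜ x :· (g :· h)) refl g x h ⟩
        x · (g · h)                  ∎

      inverts-⁻ : ∀ {g} → Inverts g → Inverts (g ⁻)
      inverts-⁻ {g} inverts = begin
        g ⁻ · x                              ≡⟨ word-solve 2 (λ g x → g :⁻ :· x ⊜ g :⁻ :· (x :· (g :· x) :· x :⁻ :· g :⁻)) refl g x ⟩
        g ⁻ · (x · (g · x) · x ⁻ · g ⁻)      ≡⟨ cong (λ a → g ⁻ · (x · a · x ⁻ · g ⁻)) inverts ⟩
        g ⁻ · (x · (x ⁻ · g) · x ⁻ · g ⁻)    ≡⟨ word-solve 2 (λ g x → g :⁻ :· (x :· (x :⁻ :· g) :· x :⁻ :· g :⁻) ⊜ x :⁻ :· g :⁻) refl g x ⟩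
        x ⁻ · g ⁻                            ∎

      -- Induction along g, g², g⁴, ... up to 1. If g² ∈ ⟨x⟩ and g ∉ ⟨x⟩, then g inverts x by
      -- `square-in⟨x⟩`. If g² inverted x, then r² ≡ -1 modulo the order of x, hence modulo 4, which
      -- is impossible.
      normalizer : ∀ {g r} → Twists g r → Mem ⟨x⟩ g ⊎ Inverts g
      normalizer {g} twist = go k g twist (↑p^k g)
        where
        go : ∀ j g {r} → Twists g r → g ↑ (2 ^ j) ≡ 𝟙 → Mem ⟨x⟩ g ⊎ Inverts g
        square : ∀ {g r} → Twists g r → Dec (Mem ⟨x⟩ g) → Mem ⟨x⟩ (g · g) ⊎ Inverts (g · g) → Mem ⟨x⟩ g ⊎ Inverts g
        square twist (yes g∈) _ = inj₁ g∈
        square twist (no g∉) (inj₁ g²∈) = inj₂ (proj₁ (square-in⟨x⟩ g∉ twist g²∈))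
        square {g} {r} twist (no g∉) (inj₂ g²-inverts) = contradiction (x-order {1 + r * r} (·-cancelʳ (g · g) (begin
          x · x ↑ (r * r) · (g · g)     ≡⟨ assoc x _ _ ⟩
          x · (x ↑ (r * r) · (g · g))   ≡⟨ cong (x ·_) (trans (sym (conjugates (twists-· twist twist))) g²-inverts) ⟩
          x · (x ⁻ · (g · g))           ≡⟨ word-solve 2 (λ x g → x :· (x :⁻ :· (g :· g)) ⊜ :1 :· (g :· g)) refl x g ⟩
          𝟙 · (g · g)                   ∎))) (4∤1+r² r)
        go zero g twist g≡𝟙 = inj₁ (0 , sym (trans (sym (↑-1 g)) g≡𝟙))
        go (suc j) g twist g↑≡𝟙 = square twist (mem? ⟨x⟩ g)
          (go j (g · g) (twists-· twist twist) (trans (cong (_↑ (2 ^ j)) (sym (↑-2 g))) (trans (sym (↑-*′ g 2 (2 ^ j))) g↑≡𝟙)))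

      centralizer : ∀ {g} → g · x ≡ x · g → Mem ⟨x⟩ g
      centralizer {g} commutes = [ (λ g∈ → g∈) , (λ inverts → contradiction commutes (¬inverts∧commutes inverts)) ]′
        (normalizer {g} {1} (twists (trans commutes (cong (_· g) (sym (↑-1 x))))))

      ∈⇒commutes : ∀ {h} → Mem ⟨x⟩ h → h · x ≡ x · h
      ∈⇒commutes (i , eq) = subst (λ h → h · x ≡ x · h) eq
        (trans (cong (x ↑ i ·_) (sym (↑-1 x))) (trans (↑-comm x i 1) (cong (_· x ↑ i) (↑-1 x))))

      -- The square g² centralises x and so lies in ⟨x⟩; `square-in⟨x⟩` applies with -1 written as
      -- 2^(n+1) - 1.
      inverting-square : ∀ {g} → Inverts g → g · g ≡ x₀
      inverting-square {g} inverts = proj₂ (square-in⟨x⟩ {g} {pred (2 ^ suc n)} (¬inverts∧commutes inverts ∘ ∈⇒commutes)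
        (twists (trans inverts (cong (_· g) x⁻≡))) (centralizer (inverts-² inverts inverts)))
        where
        x⁻≡ : x ⁻ ≡ x ↑ pred (2 ^ suc n)
        x⁻≡ = ·-cancelˡ x (trans (inverseʳ x) (sym (trans (cong (x ↑_) (suc-pred (2 ^ suc n))) (exponent x))))

      -- Defined by how its elements act on x, since `normalizer` has shown that only the identity
      -- and inversion occur.
      N⟨x⟩ : Subgroup
      N⟨x⟩ = record
        { Mem  = Normalizing
        ; mem? = λ g → mem? ⟨x⟩ g ⊎-dec (g · x ≟ x ⁻ · g)
        ; 𝟙∈   = inj₁ (𝟙∈ ⟨x⟩)
        ; ·∈   = mul
        ; ⁻∈   = Sum.map (⁻∈ ⟨x⟩) inverts-⁻
        }
        where
        Normalizing : C → Set
        Normalizing g = Mem ⟨x⟩ g ⊎ Inverts g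
        mul : ∀ {g h} → Normalizing g → Normalizing h → Normalizing (g · h)
        mul (inj₁ g∈) (inj₁ h∈) = inj₁ (·∈ ⟨x⟩ g∈ h∈)
        mul {g} {h} (inj₁ g∈) (inj₂ h-inverts) = inj₂ (begin
          g · h · x               ≡⟨ trans (assoc g h x) (cong (g ·_) h-inverts) ⟩
          g · (x ⁻ · h)           ≡⟨ word-solve 3 (λ g x h → g :· (x :⁻ :· h) ⊜ x :⁻ :· (x :· g) :· x :⁻ :· h) refl g x h ⟩
          x ⁻ · (x · g) · x ⁻ · h ≡⟨ cong (λ a → x ⁻ · a · x ⁻ · h) (sym (∈⇒commutes g∈)) ⟩
          x ⁻ · (g · x) · x ⁻ · h ≡⟨ word-solve 3 (λ g x h → x :⁻ :· (g :· x) :· x :⁻ :· h ⊜ x :⁻ :· (g :· h)) refl g x h ⟩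
          x ⁻ · (g · h)           ∎)
        mul {g} {h} (inj₂ g-inverts) (inj₁ h∈) = inj₂ (begin
          g · h · x               ≡⟨ trans (assoc g h x) (cong (g ·_) (∈⇒commutes h∈)) ⟩
          g · (x · h)             ≡⟨ sym (assoc g x h) ⟩
          g · x · h               ≡⟨ cong (_· h) g-inverts ⟩
          x ⁻ · g · h             ≡⟨ assoc (x ⁻) g h ⟩
          x ⁻ · (g · h)           ∎)
        mul (inj₂ g-inverts) (inj₂ h-inverts) = inj₁ (centralizer (inverts-² g-inverts h-inverts))

      exponent-4 : x · x ≡ x₀ → ∀ g → g · g · (g · g) ≡ 𝟙
      exponent-4 x²≡x₀ g = begin
        g · g · (g · g)      ≡⟨ sym (trans (↑-*′ g 2 2) (trans (cong (_↑ 2) (↑-2 g)) (↑-2 (g · g)))) ⟩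
        g ↑ 4                ≡⟨ ∣⇒↑≡𝟙 {g} {2 ^ suc n} {4} (exponent g) (x-period {4} x⁴≡𝟙) ⟩
        𝟙                    ∎
        where
        x⁴≡𝟙 : x ↑ 4 ≡ 𝟙
        x⁴≡𝟙 = trans (↑-*′ x 2 2) (trans (cong (_↑ 2) (trans (↑-2 x) x²≡x₀)) x₀↑2)

      square∈ : x · x ≡ x₀ → ∀ g → Mem ⟨x⟩ (g · g)
      square∈ x²≡x₀ g = involution∈ (exponent-4 x²≡x₀ g)

      normalizing⇒∈N : ∀ {g} → Mem ⟨x⟩ (g · x · g ⁻) → Mem N⟨x⟩ g
      normalizing⇒∈N gxg⁻∈ = normalizer (proj₂ (normalizing⇒twists gxg⁻∈))

      -- An element normalising N⟨x⟩ but not ⟨x⟩ conjugates x to an element with square x₀,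
      -- so x has order 4, all squares lie in ⟨x₀⟩, and ⟨x⟩ is normal after all.
      N⟨x⟩-full : ∀ g → Mem N⟨x⟩ g
      N⟨x⟩-full b = decidable-stable (mem? N⟨x⟩ b) λ b∉ →
        let g , g∉ , normal = normalizer-grows N⟨x⟩ b∉
        in g∉ (subst (Mem N⟨x⟩) (word-solve 1 (λ g → g :⁻ :⁻ ⊜ g) refl g)
             (⁻∈ N⟨x⟩ (normalizing⇒∈N {g ⁻} (conjugate∈ g (normal (inj₁ (1 , ↑-1 x)))))))
        where
        conjugate∈ : ∀ g → Mem N⟨x⟩ (g ⁻ · (x · g)) → Mem ⟨x⟩ (g ⁻ · x · g ⁻ ⁻)
        conjugate∈ g (inj₁ w∈) = subst (Mem ⟨x⟩) (word-solve 2 (λ g x → g :⁻ :· (x :· g) ⊜ g :⁻ :· x :· g :⁻ :⁻) refl g x) w∈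
        conjugate∈ g (inj₂ w-inverts) = subst (Mem ⟨x⟩)
          -- With u = g⁻¹, the identity uxu⁻¹ = (ux)² x⁻¹ (u²)⁻¹ writes the conjugate through
          -- squares, which all lie in ⟨x⟩.
          (word-solve 2 (λ u x → u :· x :· (u :· x) :· x :⁻ :· (u :· u) :⁻ ⊜ u :· x :· u :⁻) refl (g ⁻) x)
          (·∈ ⟨x⟩ (·∈ ⟨x⟩ (square∈ x²≡x₀ (g ⁻ · x)) (⁻∈ ⟨x⟩ (1 , ↑-1 x))) (⁻∈ ⟨x⟩ (square∈ x²≡x₀ (g ⁻))))
          where
          x²≡x₀ : x · x ≡ x₀
          x²≡x₀ = begin
            x · x                                        ≡⟨ word-solve 2 (λ g x → x :· x ⊜ g :· (g :⁻ :· (x :· g) :· (g :⁻ :· (x :· g))) :· g :⁻) refl g x ⟩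
            g · (g ⁻ · (x · g) · (g ⁻ · (x · g))) · g ⁻  ≡⟨ cong (λ a → g · a · g ⁻) (inverting-square w-inverts) ⟩
            g · x₀ · g ⁻                                 ≡⟨ cong (_· g ⁻) (x₀-central g) ⟩
            x₀ · g · g ⁻                                 ≡⟨ word-solve 2 (λ a g → a :· g :· g :⁻ ⊜ a) refl x₀ g ⟩
            x₀                                           ∎

      -- If g inverts x, then gy⁻¹ centralises x and is therefore a power of x.
      decomposition : ∀ g → ∃[ i ] (g ≡ x ↑ i ⊎ g ≡ x ↑ i · y)
      decomposition g = [ (λ (i , eq) → i , inj₁ (sym eq)) , outside ]′ (N⟨x⟩-full g)
        where
        outside : Inverts g → ∃[ i ] (g ≡ x ↑ i ⊎ g ≡ x ↑ i · y)
        outside g-inverts = let i , eq = centralizer (inverts-² g-inverts (inverts-⁻ y-inverts)) in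
          i , inj₂ (trans (word-solve 2 (λ g y → g ⊜ g :· y :⁻ :· y) refl g y) (cong (_· y) (sym eq)))

-- Generalized quaternion groups

toℕ-mod : ∀ i m .{{_ : NonZero m}} → toℕ (i mod m) ≡ i % m
toℕ-mod i m = toℕ-fromℕ< (m%n<n i m)

module QuaternionRecognition (G : FiniteGroup) (k : ℕ) where
  open GroupTheory G
  open Quaternion k
  open ≡-Reasoning

  module _ (x y : C) (x-torsion : x ↑ m ≡ 𝟙) (x-injective : ∀ {i j} → i < m → j < m → x ↑ i ≡ x ↑ j → i ≡ j)
    (y∉ : ∀ i → x ↑ i ≢ y) (y-inverts : y · x ≡ x ⁻ · y) (y² : y · y ≡ x ↑ (2 ^ (k + 1)))
    (decomposition : ∀ g → ∃[ i ] (g ≡ x ↑ i ⊎ g ≡ x ↑ i · y)) where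

    ↑-mod : ∀ i → x ↑ toℕ (i mod m) ≡ x ↑ i
    ↑-mod i = trans (cong (x ↑_) (toℕ-mod i m)) (sym (↑-% x i m x-torsion))

    element : Q → C
    element (a , false) = x ↑ toℕ a
    element (a , true)  = x ↑ toℕ a · y

    y·xⁱ : ∀ i → y · x ↑ i ≡ (x ↑ i) ⁻ · y
    y·xⁱ zero = word-solve 1 (λ y → y :· :1 ⊜ :1 :⁻ :· y) refl y
    y·xⁱ (suc i) = begin
      y · (x · x ↑ i)            ≡⟨ sym (assoc _ _ _) ⟩
      y · x · x ↑ i              ≡⟨ cong (_· x ↑ i) y-inverts ⟩
      x ⁻ · y · x ↑ i            ≡⟨ assoc _ _ _ ⟩
      x ⁻ · (y · x ↑ i)          ≡⟨ cong (x ⁻ ·_) (y·xⁱ i) ⟩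
      x ⁻ · ((x ↑ i) ⁻ · y)      ≡⟨ word-solve 3 (λ x a y → x :⁻ :· (a :⁻ :· y) ⊜ (a :· x) :⁻ :· y) refl x (x ↑ i) y ⟩
      (x ↑ i · x) ⁻ · y          ≡⟨ cong (λ a → a ⁻ · y) xⁱ·x ⟩
      (x · x ↑ i) ⁻ · y          ∎
      where
      xⁱ·x : x ↑ i · x ≡ x · x ↑ i
      xⁱ·x = trans (cong (x ↑ i ·_) (sym (↑-1 x))) (trans (↑-comm x i 1) (cong (_· x ↑ i) (↑-1 x)))

    ↑-m∸ : (c : Fin m) → x ↑ (m ∸ toℕ c) ≡ (x ↑ toℕ c) ⁻
    ↑-m∸ c = ·-cancelˡ (x ↑ toℕ c) (trans (sym (↑-+ x (toℕ c) _))
      (trans (cong (x ↑_) (m+[n∸m]≡n (<⇒≤ (toℕ<n c)))) (trans x-torsion (sym (inverseʳ _)))))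

    xᵃyxᶜ : ∀ a (c : Fin m) → x ↑ a · y · x ↑ toℕ c ≡ x ↑ (a + (m ∸ toℕ c)) · y
    xᵃyxᶜ a c = begin
      x ↑ a · y · x ↑ toℕ c                ≡⟨ assoc _ _ _ ⟩
      x ↑ a · (y · x ↑ toℕ c)              ≡⟨ cong (x ↑ a ·_) (y·xⁱ (toℕ c)) ⟩
      x ↑ a · ((x ↑ toℕ c) ⁻ · y)          ≡⟨ cong (λ b → x ↑ a · (b · y)) (sym (↑-m∸ c)) ⟩
      x ↑ a · (x ↑ (m ∸ toℕ c) · y)        ≡⟨ sym (assoc _ _ _) ⟩
      x ↑ a · x ↑ (m ∸ toℕ c) · y          ≡⟨ cong (_· y) (sym (↑-+ x a _)) ⟩
      x ↑ (a + (m ∸ toℕ c)) · y            ∎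

    element-⋆ : ∀ u v → element (u ⋆ v) ≡ element u · element v
    element-⋆ (a , false) (c , false) = trans (↑-mod (toℕ a + toℕ c)) (↑-+ x (toℕ a) (toℕ c))
    element-⋆ (a , false) (c , true)  = trans (cong (_· y) (trans (↑-mod (toℕ a + toℕ c)) (↑-+ x (toℕ a) (toℕ c)))) (assoc _ _ _)
    element-⋆ (a , true)  (c , false) = trans (cong (_· y) (↑-mod (toℕ a + (m ∸ toℕ c)))) (sym (xᵃyxᶜ (toℕ a) c))
    element-⋆ (a , true)  (c , true)  = begin
      x ↑ toℕ ((toℕ a + (m ∸ toℕ c) + 2 ^ (k + 1)) mod m)   ≡⟨ ↑-mod (toℕ a + (m ∸ toℕ c) + 2 ^ (k + 1)) ⟩
      x ↑ (toℕ a + (m ∸ toℕ c) + 2 ^ (k + 1))               ≡⟨ ↑-+ x (toℕ a + (m ∸ toℕ c)) _ ⟩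
      x ↑ (toℕ a + (m ∸ toℕ c)) · x ↑ (2 ^ (k + 1))         ≡⟨ cong (x ↑ (toℕ a + (m ∸ toℕ c)) ·_) (sym y²) ⟩
      x ↑ (toℕ a + (m ∸ toℕ c)) · (y · y)                   ≡⟨ sym (assoc _ _ _) ⟩
      x ↑ (toℕ a + (m ∸ toℕ c)) · y · y                     ≡⟨ cong (_· y) (sym (xᵃyxᶜ (toℕ a) c)) ⟩
      x ↑ toℕ a · y · x ↑ toℕ c · y                         ≡⟨ assoc _ _ _ ⟩
      x ↑ toℕ a · y · (x ↑ toℕ c · y)                       ∎

    powers≢xᶜy : ∀ (a c : Fin m) → x ↑ toℕ a ≢ x ↑ toℕ c · y
    powers≢xᶜy a c eq = y∉ (m ∸ toℕ c + toℕ a) (begin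
      x ↑ (m ∸ toℕ c + toℕ a)             ≡⟨ ↑-+ x (m ∸ toℕ c) (toℕ a) ⟩
      x ↑ (m ∸ toℕ c) · x ↑ toℕ a         ≡⟨ cong₂ _·_ (↑-m∸ c) eq ⟩
      (x ↑ toℕ c) ⁻ · (x ↑ toℕ c · y)     ≡⟨ word-solve 2 (λ b y → b :⁻ :· (b :· y) ⊜ y) refl (x ↑ toℕ c) y ⟩
      y                                   ∎)

    ↑toℕ-injective : ∀ {a c : Fin m} → x ↑ toℕ a ≡ x ↑ toℕ c → a ≡ c
    ↑toℕ-injective {a} {c} eq = toℕ-injective (x-injective (toℕ<n a) (toℕ<n c) eq)

    element-injective : ∀ {u v} → element u ≡ element v → u ≡ v
    element-injective {a , false} {c , false} eq = cong (_, false) (↑toℕ-injective eq)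
    element-injective {a , false} {c , true}  eq = contradiction eq (powers≢xᶜy a c)
    element-injective {a , true}  {c , false} eq = contradiction (sym eq) (powers≢xᶜy c a)
    element-injective {a , true}  {c , true}  eq = cong (_, true) (↑toℕ-injective (·-cancelʳ y eq))

    coordinates : ∀ g → ∃[ u ] element u ≡ g
    coordinates g with decomposition g
    ... | i , inj₁ refl = (i mod m , false) , ↑-mod i
    ... | i , inj₂ refl = (i mod m , true) , cong (_· y) (↑-mod i)

    -- The explicit map `element` runs from Q to G and respects products; `f` is its inverse, and
    -- multiplicativity passes to `f` because `element` is injective.
    isGeneralizedQuaternion : IsGeneralizedQuaternion G
    isGeneralizedQuaternion = k , f , (injective , surjective) , λ g h → element-injective
      (trans (section (g · h)) (sym (trans (element-⋆ (f g) (f h)) (cong₂ _·_ (section g) (section h)))))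
      where
      f : C → Q
      f g = proj₁ (coordinates g)
      section : ∀ g → element (f g) ≡ g
      section g = proj₂ (coordinates g)
      injective : ∀ {g h} → f g ≡ f h → g ≡ h
      injective {g} {h} eq = trans (sym (section g)) (trans (cong element eq) (section h))
      surjective : ∀ u → ∃[ g ] (∀ {h} → h ≡ g → f h ≡ u)
      surjective u = element u , λ { refl → element-injective (section (element u)) }

-- The cone vertex v corresponds to x^(2^(k+1)), the involution of the cyclic part. It is joined to
-- xᵃ through x, and to xᵃy through xᵃy itself, whose square is v.
cone⇐quaternion : (G : FiniteGroup) → IsGeneralizedQuaternion G → ConeProperty G
cone⇐quaternion G (k , f , (injective , surjective) , homo) = v , v≢𝟙 , λ w w≢v → w≢v ∘ sym , generator w (f w) refl
  where
  open GroupTheory G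
  open Quaternion k
  open ≡-Reasoning
  f⁻¹ : Q → C
  f⁻¹ u = proj₁ (surjective u)
  f∘f⁻¹ : ∀ u → f (f⁻¹ u) ≡ u
  f∘f⁻¹ u = proj₂ (surjective u) refl
  mod-cong : ∀ {i j} → i % m ≡ j % m → i mod m ≡ j mod m
  mod-cong {i} {j} eq = toℕ-injective (trans (toℕ-mod i m) (trans eq (sym (toℕ-mod j m))))
  toℕ-mod-id : (a : Fin m) → toℕ a mod m ≡ a
  toℕ-mod-id a = toℕ-injective (trans (toℕ-mod (toℕ a) m) (m<n⇒m%n≡m (toℕ<n a)))
  half<m : 2 ^ (k + 1) < m
  half<m = ^-monoʳ-< 2 (s≤s (s≤s z≤n)) (+-monoʳ-< k (s≤s (s≤s z≤n)))
  x v : C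
  x = f⁻¹ (1 mod m , false)
  v = f⁻¹ (2 ^ (k + 1) mod m , false)
  f-power : ∀ i → f (x ↑ suc i) ≡ (suc i mod m , false)
  f-power zero = trans (cong f (identityʳ x)) (f∘f⁻¹ _)
  f-power (suc i) = begin
    f (x · x ↑ suc i)                                   ≡⟨ homo x (x ↑ suc i) ⟩
    f x ⋆ f (x ↑ suc i)                                 ≡⟨ cong₂ _⋆_ (f∘f⁻¹ _) (f-power i) ⟩
    ((toℕ (1 mod m) + toℕ (suc i mod m)) mod m , false) ≡⟨ cong (_, false) (mod-cong (begin
        (toℕ (1 mod m) + toℕ (suc i mod m)) % m           ≡⟨ cong₂ (λ a b → (a + b) % m) (toℕ-mod 1 m) (toℕ-mod (suc i) m) ⟩
        (1 % m + suc i % m) % m                           ≡⟨ sym (%-distribˡ-+ 1 (suc i) m) ⟩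
        suc (suc i) % m                                   ∎)) ⟩
    (suc (suc i) mod m , false)                         ∎
  x-power : ∀ {w i} .{{_ : NonZero i}} → f w ≡ (i mod m , false) → w ≡ x ↑ suc (pred i)
  x-power {i = suc i} eq = injective (trans eq (sym (f-power i)))
  instance
    half-nonZero : NonZero (2 ^ (k + 1))
    half-nonZero = m^n≢0 2 (k + 1)
  v≢𝟙 : v ≢ 𝟙
  v≢𝟙 v≡𝟙 = <⇒≢ (0<half) (sym half≡0)
    where
    -- The coordinates of 𝟙 have not been computed, so v ≡ 𝟙 is refuted by comparing v · w with w,
    -- where w is the element y of Q.
    w : C
    w = f⁻¹ (0 mod m , true)
    0<half : 0 < 2 ^ (k + 1)
    0<half = m^n>0 2 (k + 1)
    fixed : ((toℕ (2 ^ (k + 1) mod m) + toℕ (0 mod m)) mod m , true) ≡ (0 mod m , true)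
    fixed = begin
      (2 ^ (k + 1) mod m , false) ⋆ (0 mod m , true)  ≡⟨ sym (cong₂ _⋆_ (f∘f⁻¹ _) (f∘f⁻¹ _)) ⟩
      f v ⋆ f w                                       ≡⟨ sym (homo v w) ⟩
      f (v · w)                                       ≡⟨ cong (λ a → f (a · w)) v≡𝟙 ⟩
      f (𝟙 · w)                                       ≡⟨ cong f (identityˡ w) ⟩
      f w                                             ≡⟨ f∘f⁻¹ _ ⟩
      (0 mod m , true)                                ∎
    half≡0 : 2 ^ (k + 1) ≡ 0
    half≡0 = begin
      2 ^ (k + 1)                                              ≡⟨ sym (m<n⇒m%n≡m half<m) ⟩
      2 ^ (k + 1) % m                                          ≡⟨ cong (_% m) (sym (+-identityʳ _)) ⟩
      (2 ^ (k + 1) + 0) % m                                    ≡⟨ %-distribˡ-+ (2 ^ (k + 1)) 0 m ⟩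
      (2 ^ (k + 1) % m + 0 % m) % m                            ≡⟨ sym (cong₂ (λ a b → (a + b) % m) (toℕ-mod (2 ^ (k + 1)) m) (toℕ-mod 0 m)) ⟩
      (toℕ (2 ^ (k + 1) mod m) + toℕ (0 mod m)) % m            ≡⟨ sym (toℕ-mod _ m) ⟩
      toℕ ((toℕ (2 ^ (k + 1) mod m) + toℕ (0 mod m)) mod m)    ≡⟨ cong (toℕ ∘ proj₁) fixed ⟩
      toℕ (0 mod m)                                            ≡⟨ toℕ-mod 0 m ⟩
      0 % m                                                    ≡⟨ m<n⇒m%n≡m (m^n>0 2 (k + 2)) ⟩
      0                                                        ∎
  generator : ∀ w u → f w ≡ u → ∃[ z ] ∃[ i ] ∃[ j ] (v ≡ z ↑ suc i × w ≡ z ↑ suc j)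
  -- The exponent a + m replaces a, which may be 0, because adjacency asks for positive exponents.
  generator w (a , false) fw≡ = x , pred (2 ^ (k + 1)) , pred (toℕ a + m) , x-power (f∘f⁻¹ _) ,
    x-power {{a+m-nonZero}} (trans fw≡ (cong (_, false) (trans (sym (toℕ-mod-id a)) (mod-cong (sym ([m+n]%n≡m%n (toℕ a) m))))))
    where
    a+m-nonZero : NonZero (toℕ a + m)
    a+m-nonZero = ≢-nonZero (λ eq → <⇒≢ (m^n>0 2 (k + 2)) (sym (m+n≡0⇒n≡0 (toℕ a) eq)))
  -- Here z = w, with v = w² and w = w¹; the stored numbers are the exponents minus one.
  generator w (a , true) fw≡ = w , 1 , 0 , injective (begin
    f v                                                    ≡⟨ f∘f⁻¹ _ ⟩
    (2 ^ (k + 1) mod m , false)                            ≡⟨ cong (_, false) (mod-cong (begin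
        2 ^ (k + 1) % m                                      ≡⟨ sym ([m+n]%n≡m%n (2 ^ (k + 1)) m) ⟩
        (2 ^ (k + 1) + m) % m                                ≡⟨ cong (_% m) (+-comm (2 ^ (k + 1)) m) ⟩
        (m + 2 ^ (k + 1)) % m                                ≡⟨ cong (λ b → (b + 2 ^ (k + 1)) % m) (sym (m+[n∸m]≡n (<⇒≤ (toℕ<n a)))) ⟩
        (toℕ a + (m ∸ toℕ a) + 2 ^ (k + 1)) % m              ∎)) ⟩
    (a , true) ⋆ (a , true)                                ≡⟨ sym (cong₂ _⋆_ fw≡ fw≡) ⟩
    f w ⋆ f w                                              ≡⟨ sym (homo w w) ⟩
    f (w · w)                                              ≡⟨ cong (λ a → f (w · a)) (sym (identityʳ w)) ⟩
    f (w · (w · 𝟙))                                        ∎) , sym (identityʳ w)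

-- Cone vertices

module Cone (p : ℕ) (p-prime : Prime p) (G : FiniteGroup) (k : ℕ) (∣G∣≡p^k : order G ≡ p ^ k)
  (v : Carrier G) (isCone : IsConeVertex G v) where

  open PGroup p p-prime G k ∣G∣≡p^k
  open GroupTheory G
  open ≡-Reasoning

  common-root : ∀ w → ∃[ z ] ∃[ i ] ∃[ j ] v ≡ z ↑ i × w ≡ z ↑ j
  common-root w = go (w ≟ v)
    where
    go : Dec (w ≡ v) → ∃[ z ] ∃[ i ] ∃[ j ] v ≡ z ↑ i × w ≡ z ↑ j
    go (yes w≡v) = v , 1 , 1 , sym (↑-1 v) , trans w≡v (sym (↑-1 v))
    go (no w≢v)  = let _ , z , i , j , v≡ , w≡ = proj₂ isCone w w≢v in z , suc i , suc j , v≡ , w≡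

  power-of-order-p : ∃[ a ] v ↑ (p ^ a) ≢ 𝟙 × (v ↑ (p ^ a)) ↑ p ≡ 𝟙
  power-of-order-p = order-p-power (proj₁ isCone)

  c : C
  c = v ↑ (p ^ proj₁ power-of-order-p)

  c≢𝟙 : c ≢ 𝟙
  c≢𝟙 = proj₁ (proj₂ power-of-order-p)

  cᵖ≡𝟙 : c ↑ p ≡ 𝟙
  cᵖ≡𝟙 = proj₂ (proj₂ power-of-order-p)

  common-root-c : ∀ w → ∃[ z ] ∃[ i ] ∃[ j ] c ≡ z ↑ i × w ≡ z ↑ j
  common-root-c w = let z , i , j , v≡ , w≡ = common-root w ; e = p ^ proj₁ power-of-order-p in
    z , i * e , j , trans (cong (_↑ e) v≡) (sym (↑-*′ z i e)) , w≡

  c-central : ∀ g → g · c ≡ c · g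
  c-central g = let z , i , j , c≡ , g≡ = common-root-c g in
    trans (cong₂ _·_ g≡ c≡) (trans (↑-comm z j i) (sym (cong₂ _·_ c≡ g≡)))

  ∈⟨c⟩ : ∀ {w} → w ↑ p ≡ 𝟙 → ∃[ i ] c ↑ i ≡ w
  ∈⟨c⟩ {w} wᵖ≡𝟙 =
    let z , i , j , c≡ , w≡ = common-root-c w
        l , eq = same-order-p-subgroup {z} i j (trans (cong (_↑ p) (sym c≡)) cᵖ≡𝟙) (trans (cong (_↑ p) (sym w≡)) wᵖ≡𝟙)
                   (c≢𝟙 ∘ trans c≡)
    in l , trans (cong (_↑ l) c≡) (trans eq (sym w≡))

  c∈⟨_⟩ : ∀ {w} → w ≢ 𝟙 → w ↑ p ≡ 𝟙 → ∃[ i ] w ↑ i ≡ c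
  c∈⟨_⟩ {w} w≢𝟙 wᵖ≡𝟙 =
    let z , i , j , c≡ , w≡ = common-root-c w
        l , eq = same-order-p-subgroup {z} j i (trans (cong (_↑ p) (sym w≡)) wᵖ≡𝟙) (trans (cong (_↑ p) (sym c≡)) cᵖ≡𝟙)
                   (w≢𝟙 ∘ trans w≡)
    in l , trans (cong (_↑ l) w≡) (trans eq (sym c≡))

  order-p-central : ∀ {w} → w ↑ p ≡ 𝟙 → ∀ g → g · w ≡ w · g
  order-p-central {w} wᵖ≡𝟙 g = let i , eq = ∈⟨c⟩ wᵖ≡𝟙 in subst (λ w → g · w ≡ w · g) eq (power i)
    where
    power : ∀ i → g · c ↑ i ≡ c ↑ i · g
    power zero    = trans (identityʳ g) (sym (identityˡ g))
    power (suc i) = begin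
      g · (c · c ↑ i)    ≡⟨ sym (assoc _ _ _) ⟩
      g · c · c ↑ i      ≡⟨ cong (_· c ↑ i) (c-central g) ⟩
      c · g · c ↑ i      ≡⟨ assoc _ _ _ ⟩
      c · (g · c ↑ i)    ≡⟨ cong (c ·_) (power i) ⟩
      c · (c ↑ i · g)    ≡⟨ sym (assoc _ _ _) ⟩
      c · c ↑ i · g      ∎

  -- Transfers uniqueness from c to any other element t of order p: c is a power of t, and w is a
  -- power of c.
  order-p-unique : ∀ {t} → t ≢ 𝟙 → t ↑ p ≡ 𝟙 → ∀ {w} → w ↑ p ≡ 𝟙 → ∃[ i ] t ↑ i ≡ w
  order-p-unique {t} t≢𝟙 tᵖ≡𝟙 wᵖ≡𝟙 = let l , c≡ = c∈⟨_⟩ t≢𝟙 tᵖ≡𝟙 ; i , w≡ = ∈⟨c⟩ wᵖ≡𝟙 in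
    l * i , trans (↑-*′ t l i) (trans (cong (_↑ i) c≡) w≡)

  -- Take the least l such that p^l annihilates every element. It is not 0 because v ≠ 𝟙, and
  -- minimality at l - 1 yields x.
  ∃-maximal : ∃[ n ] (∀ g → g ↑ (p ^ suc n) ≡ 𝟙) × ∃[ x ] x ↑ (p ^ n) ≢ 𝟙
  ∃-maximal = go (least {λ n → ∀ g → g ↑ (p ^ n) ≡ 𝟙} (λ n → all? (λ g → g ↑ (p ^ n) ≟ 𝟙)) {k} ↑p^k)
    where
    go : ∃[ l ] (∀ g → g ↑ (p ^ l) ≡ 𝟙) × (∀ {j} → j < l → ¬ (∀ g → g ↑ (p ^ j) ≡ 𝟙)) →
      ∃[ n ] (∀ g → g ↑ (p ^ suc n) ≡ 𝟙) × ∃[ x ] x ↑ (p ^ n) ≢ 𝟙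
    go (zero  , trivial , _)      = contradiction (trans (sym (↑-1 v)) (trivial v)) (proj₁ isCone)
    go (suc n , exponent , minimal) = n , exponent , ¬∀⟶∃¬ _ _ (λ g → g ↑ (p ^ n) ≟ 𝟙) (minimal (n<1+n n))

  n : ℕ
  n = proj₁ ∃-maximal

  exponent : ∀ g → g ↑ (p ^ suc n) ≡ 𝟙
  exponent = proj₁ (proj₂ ∃-maximal)

  x : C
  x = proj₁ (proj₂ (proj₂ ∃-maximal))

  x₀≢𝟙 : x ↑ (p ^ n) ≢ 𝟙
  x₀≢𝟙 = proj₂ (proj₂ (proj₂ ∃-maximal))

  x₀ᵖ≡𝟙 : (x ↑ (p ^ n)) ↑ p ≡ 𝟙
  x₀ᵖ≡𝟙 = trans (sym (↑-* x p (p ^ n))) (exponent x)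

  x₀-central : ∀ g → g · x ↑ (p ^ n) ≡ x ↑ (p ^ n) · g
  x₀-central = order-p-central x₀ᵖ≡𝟙

  unique : ∀ {w} → w ↑ p ≡ 𝟙 → ∃[ i ] (x ↑ (p ^ n)) ↑ i ≡ w
  unique = order-p-unique x₀≢𝟙 x₀ᵖ≡𝟙

  open Exponent n exponent x x₀≢𝟙 x₀-central unique public using (⟨x⟩; odd⇒cyclic)

  nonabelian⇒noncyclic : ¬ IsAbelian G → ∃[ a ] ¬ Subgroup.Mem ⟨x⟩ a
  nonabelian⇒noncyclic nonabelian = ¬∀⟶∃¬ _ _ (Subgroup.mem? ⟨x⟩) λ all → nonabelian λ g h →
    let i , g≡ = all g ; j , h≡ = all h in
    trans (cong₂ _·_ (sym g≡) (sym h≡)) (trans (↑-comm x i j) (cong₂ _·_ h≡ g≡))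

cone⇒quaternion : (k : ℕ) (G : FiniteGroup) (∣G∣≡2^k : order G ≡ 2 ^ k) → ¬ IsAbelian G → ConeProperty G → IsGeneralizedQuaternion G
cone⇒quaternion k G ∣G∣≡2^k nonabelian (v , isCone) = build (proj₁ ∃-pred) (proj₂ ∃-pred)
  where
  open GroupTheory G
  open Cone 2 prime[2] G k ∣G∣≡2^k v isCone using (n; exponent; x; x₀≢𝟙; x₀-central; unique; nonabelian⇒noncyclic)
  open TwoGroup G k ∣G∣≡2^k using (module UniqueInvolution)
  open UniqueInvolution n exponent x x₀≢𝟙 x₀-central unique using (x-period; module Noncyclic)
  open Noncyclic (proj₂ (nonabelian⇒noncyclic nonabelian))
  -- The parameter of the quaternion group is n - 1, since ⟨x⟩ has order 2^(n+1) = 2^((n-1)+2).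
  build : ∀ m → n ≡ suc m → IsGeneralizedQuaternion G
  build m n≡ = QuaternionRecognition.isGeneralizedQuaternion G m x y
    (trans (cong (λ e → x ↑ (2 ^ e)) m+2≡) (exponent x)) injective (λ i eq → y∉ (i , eq)) y-inverts
    (trans y² (cong (λ e → x ↑ (2 ^ e)) (trans n≡ (+-comm 1 m)))) decomposition
    where
    m+2≡ : m + 2 ≡ suc n
    m+2≡ = trans (+-comm m 2) (cong suc (sym n≡))
    distinct : ∀ {i j} → i < j → j < 2 ^ (m + 2) → x ↑ i ≢ x ↑ j
    distinct {i} {j} i<j j<q eq = >⇒∤ {{>-nonZero (m<n⇒0<n∸m i<j)}}
      (subst (λ e → j ∸ i < 2 ^ e) m+2≡ (≤-<-trans (m∸n≤m j i) j<q))
      (x-period {j ∸ i} (↑-∸ x (<⇒≤ i<j) eq))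
    injective : ∀ {i j} → i < 2 ^ (m + 2) → j < 2 ^ (m + 2) → x ↑ i ≡ x ↑ j → i ≡ j
    injective {i} {j} i<q j<q eq = compare (<-cmp i j)
      where
      compare : Tri (i < j) (i ≡ j) (j < i) → i ≡ j
      compare (tri< i<j _ _) = contradiction eq (distinct i<j j<q)
      compare (tri≈ _ i≡j _) = i≡j
      compare (tri> _ _ j<i) = contradiction (sym eq) (distinct j<i i<q)

theorem3p3 : (p : ℕ) → Prime p → (G : FiniteGroup) → IsPGroup p G → ¬ IsAbelian G →
    (ConeProperty G ⇔ IsGeneralizedQuaternion G)
theorem3p3 p p-prime G (k , ∣G∣≡p^k) nonabelian = mk⇔ (forward (PrimeArithmetic.p≡2∨odd p p-prime)) (cone⇐quaternion G)
  where
  forward : p ≡ 2 ⊎ ∃[ h ] p ≡ suc (2 * h) → ConeProperty G → IsGeneralizedQuaternion G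
  forward (inj₁ p≡2) cone = cone⇒quaternion k G (trans ∣G∣≡p^k (cong (_^ k) p≡2)) nonabelian cone
  -- For odd p a cone vertex forces G = ⟨x⟩, contradicting that G is non-abelian.
  forward (inj₂ (h , p≡)) (v , isCone) =
    let open Cone p p-prime G k ∣G∣≡p^k v isCone
        a , a∉ = nonabelian⇒noncyclic nonabelian
    in contradiction (odd⇒cyclic {h} p≡ a) a∉
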